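{- Let $p$ be a prime and $r\in\mathbb Z$. Let $n_0\in\{0,\ldots,p-1\}$ and $n_1\in\{0,\ldots,p-2\}$. If $n_0\le n_1$, then $$B_{n_1-n_0}^{(p-n_0)}(-r)\equiv\frac1{(n_1)_{n_0}}\sum_{k=0}^{n_0}\binom{n_0}k(-1)^{n_0-k}(k-r)^{n_1}\pmod p.$$ If $n_0>n_1=0$, then $$B_{p-n_0+n_1-1}^{(p-n_0)}(-r)\equiv\frac{(-1)^{\{r\}_p-1}}{n_0!}\binom{n_0}{\{r\}_p}\pmod p.$$ If $n_0>n_1>0$, then $$B_{p-n_0+n_1-1}^{(p-n_0)}(-r)\equiv\frac{(-1)^{n_1}}{(n_0-n_1)!\,(n_1-1)!}\sum_{k=0}^{n_0}\binom{n_0}k(-1)^{k}(k-r)^{n_1}q_p(k-r)\pmod p.$$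
   Context: For $a\in\mathbb Z$ and a positive integer $m$, $\{a\}_m$ denotes the least nonnegative residue of $a$ modulo $m$. For a prime $p$ and $a\in\mathbb Z$, $q_p(a)=(a^{p-1}-1)/p$ (a rational number, which is an integer when $p\nmid a$). $(x)_0=1$ and $(x)_k=x(x-1)\cdots(x-k+1)$ for $k\ge1$. For $m\in\{0,1,2,\ldots\}$ the $m$-th order Bernoulli polynomials $B_n^{(m)}(t)$ ($n=0,1,2,\ldots$) are defined by $$\frac{x^me^{tx}}{(e^x-1)^m}=\sum_{n=0}^\infty B_n^{(m)}(t)\frac{x^n}{n!}.$$ Convention: $0^0=1$. Congruences modulo $p$ between rational numbers are understood in the ring $\mathbb Z_p$ of $p$-adic integers, i.e. $x\equiv y\pmod p$ means $x-y\in p\mathbb Z_p$. -}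

module Defs where

open import Data.Nat.Base as ℕ using (ℕ; zero; suc; _∸_; _≤_; _!)
open import Data.Nat.Properties as ℕ using (_!≢0; m∸n≤m)
open import Data.Nat.Combinatorics using (_P_; nPk≡n!/[n∸k]!)
open import Data.Nat.Divisibility using (_∣_; ∣⇒≤; m≤n⇒m!∣n!)
open import Data.Nat.DivMod using (m≥n⇒m/n>0)
open import Data.Fin.Base using (toℕ)
open import Data.Integer.Base as ℤ using (ℤ; +_; -[1+_]; 1ℤ; _^_)
open import Data.Rational.Base
  using (ℚ; NonZero; 0ℚ; 1ℚ; _+_; _-_; _*_; _/_; 1/_; ↧ₙ_; +-*-rawSemiring)
open import Data.Rational.Literals using (fromℤ)
open import Data.Rational.Properties using (+-0-commutativeMonoid)
open import Algebra.Definitions.RawSemiring +-*-rawSemiring using () renaming (_^_ to _^ℚ_)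
open import Algebra.Properties.CommutativeMonoid.Sum +-0-commutativeMonoid using (sum⁺-syntax)
open import Data.Product.Base using (∃-syntax; _×_)
open import Relation.Nullary.Negation.Core using (¬_)
open import Relation.Binary.PropositionalEquality.Core using (_≡_; subst; sym)

-- Formal power series over ℚ, as sequences of coefficients.

PowerSeries : Set
PowerSeries = ℕ → ℚ

infixl 7 _*ₛ_ _÷ₛ_
infixr 8 _^ₛ_

1ₛ : PowerSeries
1ₛ zero    = 1ℚ
1ₛ (suc _) = 0ℚ

_*ₛ_ : PowerSeries → PowerSeries → PowerSeries
(f *ₛ g) n = ∑[ k ≤ n ] (f (toℕ k) * g (n ∸ toℕ k))

_^ₛ_ : PowerSeries → ℕ → PowerSeries
f ^ₛ zero  = 1ₛ
f ^ₛ suc m = f *ₛ f ^ₛ m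

-- Long division: if c = f₀ / g₀ then f / g = c + x · (((f - c g) / x) / g).

_÷ₛ_ : (f g : PowerSeries) → .{{NonZero (g 0)}} → PowerSeries
(f ÷ₛ g) zero    = f 0 * 1/ (g 0)
(f ÷ₛ g) (suc n) = ((λ i → f (suc i) - (f 0 * 1/ (g 0)) * g (suc i)) ÷ₛ g) n

-- e^{tx}
exp : ℚ → PowerSeries
exp t n = t ^ℚ n * (1ℤ / (n !)) {{n !≢0}}

-- (e^x - 1) / x
[eˣ-1]/x : PowerSeries
[eˣ-1]/x n = exp 1ℚ (suc n)

-- The series x^m e^{tx} / (e^x - 1)^m.  Since e^x - 1 has no constant term it
-- is not invertible, so a factor x^m is cancelled: this is
-- (1 / ((e^x - 1) / x))^m e^{tx}.
bernoulliGF : ℕ → ℚ → PowerSeries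
bernoulliGF m t = (1ₛ ÷ₛ [eˣ-1]/x) ^ₛ m *ₛ exp t

-- B m n t is the value at t of the m-th order Bernoulli polynomial B_n^{(m)}.
B : ℕ → ℕ → ℚ → ℚ
B m n t = fromℤ (+ (n !)) * bernoulliGF m t n

-- The Fermat quotient.  It is an integer only when p ∤ a.
q : (p : ℕ) .{{_ : ℕ.NonZero p}} → ℤ → ℚ
q p a = (a ^ (p ∸ 1) ℤ.- 1ℤ) / p

infixr 8 _^ᶻ_

_^ᶻ_ : (x : ℚ) .{{_ : NonZero x}} → ℤ → ℚ
x ^ᶻ (+ n)    = x ^ℚ n
x ^ᶻ -[1+ n ] = (1/ x) ^ℚ suc n

-- Membership of a rational number in the ring of p-adic integers (p prime);
-- ↧ₙ is the denominator in lowest terms.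
_∈ℤₚ[_] : ℚ → ℕ → Set
z ∈ℤₚ[ p ] = ¬ (p ∣ ↧ₙ z)

infix 4 _≡_[mod_]

_≡_[mod_] : ℚ → ℚ → ℕ → Set
x ≡ y [mod p ] = ∃[ z ] (z ∈ℤₚ[ p ] × x - y ≡ fromℤ (+ p) * z)

-- The library's n P k is the falling factorial (n)_k.
nPk≢0 : ∀ {n k} → k ≤ n → ℕ.NonZero (n P k)
nPk≢0 {n} {k} k≤n = subst ℕ.NonZero (sym (nPk≡n!/[n∸k]! k≤n))
  (ℕ.>-nonZero (m≥n⇒m/n>0 (∣⇒≤ (m≤n⇒m!∣n! (m∸n≤m n k)))))
  where
  instance
    _ = (n ∸ k) !≢0
    _ = n !≢0

{-# OPTIONS --safe #-}

-- Let f = (eˣ - 1)/x, so that n! [xⁿ] f⁻ᵐ eᵗˣ is the value at t of the n-th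
-- Bernoulli polynomial of order m.  The coefficients of f below x^(p-1) are
-- p-integral, and f^p ≡ 1 there: applying θ = x d/dx gives
-- n [xⁿ] f^p = p [xⁿ] f^(p-1) θf.  Hence f^(n₀-p) may be replaced by f^n₀, and
-- x^n₀ f^n₀ = (eˣ - 1)^n₀ turns the coefficient in question into the finite
-- difference Σₖ (-1)^(n₀-k) C(n₀,k) (k+t)^N / N! with N = n + n₀.  For n₀ ≤ n₁
-- we have N = n₁ and are done.  For n₀ > n₁ we have N = p-1+n₁; the same sum
-- with the exponent n₁ vanishes, so (k+t)^N may be replaced by
-- (k+t)^N - (k+t)^n₁, which Fermat's little theorem controls.

module Submission where

open import Data.Nat.Base as ℕ using (ℕ; zero; suc; _∸_; _≤_; _<_; _>_; z≤n; s≤s; _!)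
open import Data.Nat.Properties as ℕ using (_!≢0; _!*_!≢0)
open import Data.Nat.Combinatorics using (_C_; _P_; nCk+nC[k+1]≡[n+1]C[k+1]; k>n⇒nCk≡0; nPk≡n!/[n∸k]!)
open import Data.Nat.Coprimality as Coprime using (coprime-divisor)
open import Data.Nat.Divisibility
  using (_∣_; divides; _∣0; ∣⇒≤; ∣1⇒≡1; ∣-refl; ∣-trans; ∣m+n∣m⇒∣n; m≤n⇒m!∣n!)
open import Data.Nat.DivMod using (m/n*n≡m)
open import Data.Nat.Primality using (Prime; euclidsLemma; ¬prime[1]; prime⇒nonTrivial; prime⇒nonZero)
import Data.Nat.Solver as ℕ
open import Data.Fin.Base using (toℕ)
open import Data.Integer.Base as ℤ using (ℤ; +_; 1ℤ; -1ℤ; _^_; _%ℕ_; _/ℕ_)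
import Data.Integer.Divisibility.Signed as ℤ
open import Data.Integer.DivMod using (n%ℕd<d; a≡a%ℕn+[a/ℕn]*n)
import Data.Integer.Properties as ℤ
import Data.Integer.Solver as ℤ
open import Data.Rational.Base
  using (ℚ; NonZero; mkℚ; 0ℚ; 1ℚ; -_; _+_; _-_; _*_; _/_; 1/_; ↥_; ↧_; ↧ₙ_; toℚᵘ; +-*-rawSemiring)
open import Data.Rational.Literals using (fromℤ)
open import Data.Rational.Properties
  using (↥p/↧p≡p; toℚᵘ-injective; toℚᵘ-homo-*; toℚᵘ-fromℚᵘ; +-assoc; +-identityʳ; +-inverseʳ; *-assoc; *-comm;
         *-identityˡ; *-identityʳ; *-zeroˡ; *-zeroʳ; *-distribˡ-+; *-inverseˡ; +-0-commutativeMonoid)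
open import Data.Rational.Solver using (module +-*-Solver)
import Data.Rational.Unnormalised.Base as ℚᵘ
import Data.Rational.Unnormalised.Properties as ℚᵘ
open import Algebra.Definitions.RawSemiring +-*-rawSemiring using () renaming (_^_ to _^ℚ_)
open import Algebra.Properties.CommutativeMonoid.Sum +-0-commutativeMonoid using (sum⁺-syntax; sum-cong-≗)
open import Data.Product.Base using (_×_; _,_; ∃-syntax)
open import Data.Sum.Base using (_⊎_; inj₁; inj₂; [_,_]′)
open import Function.Base using (_∘_)
open import Relation.Nullary.Decidable using (yes; no)
open import Relation.Nullary.Negation.Core using (¬_; contradiction)
open import Relation.Binary.PropositionalEquality
  using (_≡_; _≢_; _≗_; refl; sym; trans; cong; cong₂; subst; module ≡-Reasoning)
open import Defs
open +-*-Solver using (solve; _:+_; _:*_; _:-_; :-_; _:=_; con)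
open ≡-Reasoning

-- Write f = (e^x - 1)/x. In every case the index n of the Bernoulli polynomial is at most p - 2, so
-- that only coefficients of f with denominator prime to p are met. The obstacle is the factor 1/N!.
-- For n₁ = 0 we have N = p - 1, a unit factorial, and a congruence for the difference is enough:
-- Fermat removes every term except the one with k = {r}_p, where p divides k - r. For n₁ > 0 we
-- have p ≤ N < 2p, and 1/N! has exactly one p in its denominator, so a congruence modulo p for the
-- difference would say nothing. There the replacement of powers is kept as the exact equation a^N -
-- a^n₁ = p a^n₁ q_p(a) with a = k - r, and the p cancels the one in N!. When p divides a, q_p(a) is
-- not p-integral, but a q_p(a) = (a^p - a)/p is, and n₁ > 0 supplies that factor a. What remains of
-- n!/N! is brought to the stated constants by (p-1)! ≡ (-1)^a a! b! for a + b = p - 1, a form of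
-- Wilson's theorem that leaves (p-1)! unevaluated.

private
  module ℕS = ℕ.+-*-Solver
  module ℤS = ℤ.+-*-Solver

-- Integers in ℚ, unit fractions and inverse factorials

/1≡fromℤ : ∀ z → z / 1 ≡ fromℤ z
/1≡fromℤ z = ↥p/↧p≡p (fromℤ z)

fromℤ-+ : ∀ a b → fromℤ (a ℤ.+ b) ≡ fromℤ a + fromℤ b
fromℤ-+ a b = begin
  fromℤ (a ℤ.+ b)                ≡⟨ /1≡fromℤ _ ⟨
  (a ℤ.+ b) / 1                  ≡⟨ cong₂ (λ x y → (x ℤ.+ y) / 1) (ℤ.*-identityʳ a) (ℤ.*-identityʳ b) ⟨
  fromℤ a + fromℤ b              ∎

fromℤ-* : ∀ a b → fromℤ (a ℤ.* b) ≡ fromℤ a * fromℤ b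
fromℤ-* a b = sym (/1≡fromℤ _)

fromℤ-neg : ∀ a → fromℤ (ℤ.- a) ≡ - fromℤ a
fromℤ-neg (+ zero)     = refl
fromℤ-neg ℤ.+[1+ n ]   = refl
fromℤ-neg (ℤ.-[1+ n ]) = refl

fromℤ-- : ∀ a b → fromℤ (a ℤ.- b) ≡ fromℤ a - fromℤ b
fromℤ-- a b = trans (fromℤ-+ a (ℤ.- b)) (cong (_+_ (fromℤ a)) (fromℤ-neg b))

fromℤ-^ : ∀ a n → fromℤ (a ^ n) ≡ fromℤ a ^ℚ n
fromℤ-^ a zero    = refl
fromℤ-^ a (suc n) = trans (fromℤ-* a (a ^ n)) (cong (fromℤ a *_) (fromℤ-^ a n))

-- `_/_` divides out the gcd, so the equation is checked on unnormalised representatives, where it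
-- is a cross-multiplication.
/*↧ : ∀ a d .{{_ : ℕ.NonZero d}} → a / d * fromℤ (+ d) ≡ fromℤ a
/*↧ a d@(suc d-1) = toℚᵘ-injective
  (ℚᵘ.≃-trans (toℚᵘ-homo-* (a / d) (fromℤ (+ d)))
  (ℚᵘ.≃-trans (ℚᵘ.*-congʳ {toℚᵘ (fromℤ (+ d))} (toℚᵘ-fromℚᵘ (ℚᵘ.mkℚᵘ a d-1)))
              (ℚᵘ.*≡* (trans (ℤ.*-identityʳ (a ℤ.* + d)) (cong (λ k → a ℤ.* + k) (sym (ℕ.*-identityʳ d)))))))

1/*↧ : ∀ d .{{_ : ℕ.NonZero d}} → 1ℤ / d * fromℤ (+ d) ≡ 1ℚ
1/*↧ d = /*↧ 1ℤ d

*-cancelʳ-unit : ∀ {x y} u v → v * u ≡ 1ℚ → x * v ≡ y * v → x ≡ y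
*-cancelʳ-unit {x} {y} u v vu≡1 xv≡yv = begin
  x            ≡⟨ *-identityʳ x ⟨
  x * 1ℚ       ≡⟨ cong (x *_) vu≡1 ⟨
  x * (v * u)  ≡⟨ *-assoc x v u ⟨
  x * v * u    ≡⟨ cong (_* u) xv≡yv ⟩
  y * v * u    ≡⟨ *-assoc y v u ⟩
  y * (v * u)  ≡⟨ cong (y *_) vu≡1 ⟩
  y * 1ℚ       ≡⟨ *-identityʳ y ⟩
  y            ∎

/≡*1/ : ∀ a d .{{_ : ℕ.NonZero d}} → a / d ≡ fromℤ a * (1ℤ / d)
/≡*1/ a d = *-cancelʳ-unit (1ℤ / d) (fromℤ (+ d)) (trans (*-comm (fromℤ (+ d)) (1ℤ / d)) (1/*↧ d)) (begin
  a / d * fromℤ (+ d)                   ≡⟨ /*↧ a d ⟩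
  fromℤ a                               ≡⟨ *-identityʳ _ ⟨
  fromℤ a * 1ℚ                          ≡⟨ cong (fromℤ a *_) (1/*↧ d) ⟨
  fromℤ a * (1ℤ / d * fromℤ (+ d))      ≡⟨ *-assoc (fromℤ a) (1ℤ / d) (fromℤ (+ d)) ⟨
  fromℤ a * (1ℤ / d) * fromℤ (+ d)      ∎)

*-cancelʳ-fromℕ : ∀ d .{{_ : ℕ.NonZero d}} {x y} → x * fromℤ (+ d) ≡ y * fromℤ (+ d) → x ≡ y
*-cancelʳ-fromℕ d = *-cancelʳ-unit (1ℤ / d) (fromℤ (+ d)) (trans (*-comm (fromℤ (+ d)) (1ℤ / d)) (1/*↧ d))

1/! : ℕ → ℚ
1/! n = (1ℤ / (n !)) {{n !≢0}}

1/!*! : ∀ n → 1/! n * fromℤ (+ (n !)) ≡ 1ℚ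
1/!*! n = 1/*↧ (n !) {{n !≢0}}

fromℕ-suc : ∀ n → fromℤ (+ suc n) ≡ fromℤ (+ n) + 1ℚ
fromℕ-suc n = trans (cong (λ k → fromℤ (+ k)) (sym (ℕ.+-comm n 1))) (fromℤ-+ (+ n) 1ℤ)

fromℕ-! : ∀ n → fromℤ (+ (suc n !)) ≡ fromℤ (+ suc n) * fromℤ (+ (n !))
fromℕ-! n = trans (cong fromℤ (ℤ.pos-* (suc n) (n !))) (fromℤ-* (+ suc n) (+ (n !)))

1/!-suc : ∀ n → fromℤ (+ suc n) * 1/! (suc n) ≡ 1/! n
1/!-suc n = *-cancelʳ-fromℕ (n !) {{n !≢0}} (begin
  s * i * k     ≡⟨ solve 3 (λ s i k → s :* i :* k := i :* (s :* k)) refl s i k ⟩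
  i * (s * k)   ≡⟨ cong (i *_) (fromℕ-! n) ⟨
  i * fromℤ (+ (suc n !))  ≡⟨ 1/!*! (suc n) ⟩
  1ℚ            ≡⟨ 1/!*! n ⟨
  1/! n * k     ∎)
  where
  s = fromℤ (+ suc n)
  i = 1/! (suc n)
  k = fromℤ (+ (n !))

-- Formal power series

-- `(f *ₛ g) (suc n)` unfolds by computation to `f 0 * g (suc n) + (tail f *ₛ g) n`. The laws of the
-- product are therefore proved by induction on the index, with `tail f` in place of `f`.
tail : PowerSeries → PowerSeries
tail f n = f (suc n)

infixl 6 _+ₛ_
infixr 7 _·ₛ_

_+ₛ_ : PowerSeries → PowerSeries → PowerSeries
(f +ₛ g) n = f n + g n

_·ₛ_ : ℚ → PowerSeries → PowerSeries
(c ·ₛ f) n = c * f n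

*ₛ-cong : ∀ {f f′ g g′} → f ≗ f′ → g ≗ g′ → f *ₛ g ≗ f′ *ₛ g′
*ₛ-cong f≗ g≗ n = sum-cong-≗ {suc n} (λ k → cong₂ _*_ (f≗ (toℕ k)) (g≗ (n ∸ toℕ k)))

-- The mirror image of the computational unfolding, splitting off the constant term of the right
-- factor. Commutativity is the comparison of the two.
*ₛ-suc : ∀ f g n → (f *ₛ g) (suc n) ≡ f (suc n) * g 0 + (f *ₛ tail g) n
*ₛ-suc f g zero = solve 4 (λ a b c d → a :* d :+ (b :* c :+ con 0ℚ) := b :* c :+ (a :* d :+ con 0ℚ)) refl
  (f 0) (f 1) (g 0) (g 1)
*ₛ-suc f g (suc n) = begin
  f 0 * g (2 ℕ.+ n) + (tail f *ₛ g) (suc n)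
    ≡⟨ cong (_+_ (f 0 * g (2 ℕ.+ n))) (*ₛ-suc (tail f) g n) ⟩
  f 0 * g (2 ℕ.+ n) + (f (2 ℕ.+ n) * g 0 + (tail f *ₛ tail g) n)
    ≡⟨ solve 3 (λ a b c → a :+ (b :+ c) := b :+ (a :+ c))
         refl (f 0 * g (2 ℕ.+ n)) (f (2 ℕ.+ n) * g 0) ((tail f *ₛ tail g) n) ⟩
  f (2 ℕ.+ n) * g 0 + (f 0 * g (2 ℕ.+ n) + (tail f *ₛ tail g) n)           ∎

*ₛ-comm : ∀ f g → f *ₛ g ≗ g *ₛ f
*ₛ-comm f g zero    = cong (_+ 0ℚ) (*-comm (f 0) (g 0))
*ₛ-comm f g (suc n) = begin
  f 0 * g (suc n) + (tail f *ₛ g) n   ≡⟨ cong₂ _+_ (*-comm (f 0) (g (suc n))) (*ₛ-comm (tail f) g n) ⟩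
  g (suc n) * f 0 + (g *ₛ tail f) n   ≡⟨ *ₛ-suc g f n ⟨
  (g *ₛ f) (suc n)                    ∎

*ₛ-distribʳ : ∀ h f g → (f +ₛ g) *ₛ h ≗ f *ₛ h +ₛ g *ₛ h
*ₛ-distribʳ h f g zero =
  solve 3 (λ a b c → (a :+ b) :* c :+ con 0ℚ := a :* c :+ con 0ℚ :+ (b :* c :+ con 0ℚ)) refl (f 0) (g 0) (h 0)
*ₛ-distribʳ h f g (suc n) = begin
  (f 0 + g 0) * h (suc n) + ((tail f +ₛ tail g) *ₛ h) n
    ≡⟨ cong (_+_ ((f 0 + g 0) * h (suc n))) (*ₛ-distribʳ h (tail f) (tail g) n) ⟩
  (f 0 + g 0) * h (suc n) + ((tail f *ₛ h) n + (tail g *ₛ h) n)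
    ≡⟨ solve 5 (λ a b c x y → (a :+ b) :* c :+ (x :+ y) := a :* c :+ x :+ (b :* c :+ y))
         refl (f 0) (g 0) (h (suc n)) ((tail f *ₛ h) n) ((tail g *ₛ h) n) ⟩
  (f *ₛ h +ₛ g *ₛ h) (suc n) ∎

·ₛ-*ₛ : ∀ c f g → (c ·ₛ f) *ₛ g ≗ c ·ₛ (f *ₛ g)
·ₛ-*ₛ c f g zero = solve 3 (λ a b c → a :* b :* c :+ con 0ℚ := a :* (b :* c :+ con 0ℚ)) refl c (f 0) (g 0)
·ₛ-*ₛ c f g (suc n) = begin
  c * f 0 * g (suc n) + ((c ·ₛ tail f) *ₛ g) n ≡⟨ cong (_+_ (c * f 0 * g (suc n))) (·ₛ-*ₛ c (tail f) g n) ⟩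
  c * f 0 * g (suc n) + c * (tail f *ₛ g) n
    ≡⟨ solve 4 (λ a b c d → a :* b :* c :+ a :* d := a :* (b :* c :+ d))
         refl c (f 0) (g (suc n)) ((tail f *ₛ g) n) ⟩
  c * (f *ₛ g) (suc n)                         ∎

*ₛ-assoc : ∀ f g h → (f *ₛ g) *ₛ h ≗ f *ₛ (g *ₛ h)
*ₛ-assoc f g h zero =
  solve 3 (λ a b c → (a :* b :+ con 0ℚ) :* c :+ con 0ℚ := a :* (b :* c :+ con 0ℚ) :+ con 0ℚ)
       refl (f 0) (g 0) (h 0)
*ₛ-assoc f g h (suc n) = begin
  -- `tail (f *ₛ g)` is by computation `f 0 ·ₛ tail g +ₛ tail f *ₛ g`.
  (f 0 * g 0 + 0ℚ) * h (suc n) + ((f 0 ·ₛ tail g +ₛ tail f *ₛ g) *ₛ h) n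
    ≡⟨ cong (_+_ ((f 0 * g 0 + 0ℚ) * h (suc n))) (*ₛ-distribʳ h (f 0 ·ₛ tail g) (tail f *ₛ g) n) ⟩
  (f 0 * g 0 + 0ℚ) * h (suc n) + (((f 0 ·ₛ tail g) *ₛ h) n + ((tail f *ₛ g) *ₛ h) n)
    ≡⟨ cong (_+_ ((f 0 * g 0 + 0ℚ) * h (suc n)))
      (cong₂ _+_ (·ₛ-*ₛ (f 0) (tail g) h n) (*ₛ-assoc (tail f) g h n)) ⟩
  (f 0 * g 0 + 0ℚ) * h (suc n) + (f 0 * (tail g *ₛ h) n + (tail f *ₛ (g *ₛ h)) n)
    ≡⟨ solve 5 (λ a b c x y → (a :* b :+ con 0ℚ) :* c :+ (a :* x :+ y) := a :* (b :* c :+ x) :+ y) refl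
         (f 0) (g 0) (h (suc n)) ((tail g *ₛ h) n) ((tail f *ₛ (g *ₛ h)) n) ⟩
  (f *ₛ (g *ₛ h)) (suc n) ∎

*ₛ-zeroˡ : ∀ {f} g → (∀ n → f n ≡ 0ℚ) → ∀ n → (f *ₛ g) n ≡ 0ℚ
*ₛ-zeroˡ g f≗0 zero    = trans (cong (λ x → x * g 0 + 0ℚ) (f≗0 0)) (trans (+-identityʳ _) (*-zeroˡ (g 0)))
*ₛ-zeroˡ {f} g f≗0 (suc n) = begin
  f 0 * g (suc n) + (tail f *ₛ g) n
    ≡⟨ cong₂ (λ x y → x * g (suc n) + y) (f≗0 0) (*ₛ-zeroˡ g (λ k → f≗0 (suc k)) n) ⟩
  0ℚ * g (suc n) + 0ℚ                ≡⟨ +-identityʳ _ ⟩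
  0ℚ * g (suc n)                     ≡⟨ *-zeroˡ (g (suc n)) ⟩
  0ℚ                                 ∎

*ₛ-identityˡ : ∀ g → 1ₛ *ₛ g ≗ g
*ₛ-identityˡ g zero    = trans (+-identityʳ _) (*-identityˡ (g 0))
*ₛ-identityˡ g (suc n) = begin
  1ℚ * g (suc n) + (tail 1ₛ *ₛ g) n  ≡⟨ cong₂ _+_ (*-identityˡ (g (suc n))) (*ₛ-zeroˡ g (λ _ → refl) n) ⟩
  g (suc n) + 0ℚ                     ≡⟨ +-identityʳ _ ⟩
  g (suc n)                          ∎

÷ₛ-*ₛ : ∀ f g .{{_ : NonZero (g 0)}} → (f ÷ₛ g) *ₛ g ≗ f
÷ₛ-*ₛ f g zero = begin
  f 0 * 1/ (g 0) * g 0 + 0ℚ   ≡⟨ +-identityʳ _ ⟩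
  f 0 * 1/ (g 0) * g 0        ≡⟨ *-assoc (f 0) (1/ (g 0)) (g 0) ⟩
  f 0 * (1/ (g 0) * g 0)      ≡⟨ cong (f 0 *_) (*-inverseˡ (g 0)) ⟩
  f 0 * 1ℚ                    ≡⟨ *-identityʳ (f 0) ⟩
  f 0                         ∎
÷ₛ-*ₛ f g (suc n) = begin
  c * g (suc n) + ((h ÷ₛ g) *ₛ g) n           ≡⟨ cong (_+_ (c * g (suc n))) (÷ₛ-*ₛ h g n) ⟩
  c * g (suc n) + (f (suc n) - c * g (suc n))
    ≡⟨ solve 2 (λ a b → a :+ (b :- a) := b) refl (c * g (suc n)) (f (suc n)) ⟩
  f (suc n)                                   ∎
  where
  c = f 0 * 1/ (g 0)
  h : PowerSeries
  h i = f (suc i) - c * g (suc i)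

*ₛ-distribˡ : ∀ f g h → f *ₛ (g +ₛ h) ≗ f *ₛ g +ₛ f *ₛ h
*ₛ-distribˡ f g h n = begin
  (f *ₛ (g +ₛ h)) n          ≡⟨ *ₛ-comm f (g +ₛ h) n ⟩
  ((g +ₛ h) *ₛ f) n          ≡⟨ *ₛ-distribʳ f g h n ⟩
  (g *ₛ f) n + (h *ₛ f) n    ≡⟨ cong₂ _+_ (*ₛ-comm g f n) (*ₛ-comm h f n) ⟩
  (f *ₛ g) n + (f *ₛ h) n    ∎

*ₛ-·ₛ : ∀ c f g → f *ₛ (c ·ₛ g) ≗ c ·ₛ (f *ₛ g)
*ₛ-·ₛ c f g n = begin
  (f *ₛ (c ·ₛ g)) n   ≡⟨ *ₛ-comm f (c ·ₛ g) n ⟩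
  ((c ·ₛ g) *ₛ f) n   ≡⟨ ·ₛ-*ₛ c g f n ⟩
  c * (g *ₛ f) n      ≡⟨ cong (c *_) (*ₛ-comm g f n) ⟩
  c * (f *ₛ g) n      ∎

*ₛ-leftComm : ∀ f g h → f *ₛ (g *ₛ h) ≗ g *ₛ (f *ₛ h)
*ₛ-leftComm f g h n = begin
  (f *ₛ (g *ₛ h)) n   ≡⟨ *ₛ-assoc f g h n ⟨
  (f *ₛ g *ₛ h) n     ≡⟨ *ₛ-cong {g = h} (*ₛ-comm f g) (λ _ → refl) n ⟩
  (g *ₛ f *ₛ h) n     ≡⟨ *ₛ-assoc g f h n ⟩
  (g *ₛ (f *ₛ h)) n   ∎

*ₛ-congˡ : ∀ f {g h} → g ≗ h → f *ₛ g ≗ f *ₛ h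
*ₛ-congˡ f = *ₛ-cong {f} {f} (λ _ → refl)

*ₛ-congʳ : ∀ h {f g} → f ≗ g → f *ₛ h ≗ g *ₛ h
*ₛ-congʳ h f≗g = *ₛ-cong {g = h} f≗g (λ _ → refl)

^ₛ-+ : ∀ f m n g → f ^ₛ (m ℕ.+ n) *ₛ g ≗ f ^ₛ m *ₛ (f ^ₛ n *ₛ g)
^ₛ-+ f zero    n g k = sym (*ₛ-identityˡ (f ^ₛ n *ₛ g) k)
^ₛ-+ f (suc m) n g k = begin
  (f *ₛ f ^ₛ (m ℕ.+ n) *ₛ g) k           ≡⟨ *ₛ-assoc f (f ^ₛ (m ℕ.+ n)) g k ⟩
  (f *ₛ (f ^ₛ (m ℕ.+ n) *ₛ g)) k         ≡⟨ *ₛ-congˡ f (^ₛ-+ f m n g) k ⟩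
  (f *ₛ (f ^ₛ m *ₛ (f ^ₛ n *ₛ g))) k     ≡⟨ *ₛ-assoc f (f ^ₛ m) (f ^ₛ n *ₛ g) k ⟨
  (f *ₛ f ^ₛ m *ₛ (f ^ₛ n *ₛ g)) k       ∎

-- Meant for `u = 1ₛ ÷ₛ [eˣ-1]/x` and `g = exp t`, where `u ^ₛ m *ₛ g` is `bernoulliGF m t`.
^ₛ-cancel : ∀ {f u} → u *ₛ f ≗ 1ₛ → ∀ m g → f ^ₛ m *ₛ (u ^ₛ m *ₛ g) ≗ g
^ₛ-cancel {f} {u} uf≗1 zero    g k = trans (*ₛ-identityˡ (1ₛ *ₛ g) k) (*ₛ-identityˡ g k)
^ₛ-cancel {f} {u} uf≗1 (suc m) g k = begin
  (f *ₛ f ^ₛ m *ₛ (u *ₛ u ^ₛ m *ₛ g)) k       ≡⟨ *ₛ-congˡ (f *ₛ f ^ₛ m) (*ₛ-assoc u (u ^ₛ m) g) k ⟩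
  (f *ₛ f ^ₛ m *ₛ (u *ₛ (u ^ₛ m *ₛ g))) k     ≡⟨ *ₛ-assoc f (f ^ₛ m) (u *ₛ (u ^ₛ m *ₛ g)) k ⟩
  (f *ₛ (f ^ₛ m *ₛ (u *ₛ (u ^ₛ m *ₛ g)))) k   ≡⟨ *ₛ-congˡ f (*ₛ-leftComm (f ^ₛ m) u (u ^ₛ m *ₛ g)) k ⟩
  (f *ₛ (u *ₛ (f ^ₛ m *ₛ (u ^ₛ m *ₛ g)))) k   ≡⟨ *ₛ-leftComm f u (f ^ₛ m *ₛ (u ^ₛ m *ₛ g)) k ⟩
  (u *ₛ (f *ₛ (f ^ₛ m *ₛ (u ^ₛ m *ₛ g)))) k   ≡⟨ *ₛ-congˡ u (*ₛ-congˡ f (^ₛ-cancel uf≗1 m g)) k ⟩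
  (u *ₛ (f *ₛ g)) k                           ≡⟨ *ₛ-assoc u f g k ⟨
  (u *ₛ f *ₛ g) k                             ≡⟨ *ₛ-congʳ g uf≗1 k ⟩
  (1ₛ *ₛ g) k                                 ≡⟨ *ₛ-identityˡ g k ⟩
  g k                                         ∎

-- The derivation θ = x d/dx and exponential series

θ : PowerSeries → PowerSeries
θ f n = fromℤ (+ n) * f n

-- The product rule for x times `tail f`. The extra `tail f` absorbs the step from n to n + 1 in the
-- induction of `θ-*ₛ`.
tail-θ : ∀ f → tail (θ f) ≗ θ (tail f) +ₛ tail f
tail-θ f n = begin
  fromℤ (+ suc n) * f (suc n)                     ≡⟨ cong (_* f (suc n)) (fromℕ-suc n) ⟩
  (fromℤ (+ n) + 1ℚ) * f (suc n)
    ≡⟨ solve 2 (λ a b → (a :+ con 1ℚ) :* b := a :* b :+ b) refl (fromℤ (+ n)) (f (suc n)) ⟩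
  fromℤ (+ n) * f (suc n) + f (suc n)             ∎

θ-*ₛ : ∀ f g → θ (f *ₛ g) ≗ θ f *ₛ g +ₛ f *ₛ θ g
θ-*ₛ f g zero =
  solve 2 (λ a b → con 0ℚ :* (a :* b :+ con 0ℚ) := con 0ℚ :* a :* b :+ con 0ℚ :+ (a :* (con 0ℚ :* b) :+ con 0ℚ))
       refl (f 0) (g 0)
θ-*ₛ f g (suc n) = begin
  s * (f 0 * g (suc n) + (tail f *ₛ g) n)
    ≡⟨ solve 4 (λ s a b c → s :* (a :* b :+ c) := a :* (s :* b) :+ s :* c)
         refl s (f 0) (g (suc n)) ((tail f *ₛ g) n) ⟩
  f 0 * (s * g (suc n)) + s * (tail f *ₛ g) n
    ≡⟨ cong (λ z → f 0 * (s * g (suc n)) + z * (tail f *ₛ g) n) (fromℕ-suc n) ⟩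
  f 0 * (s * g (suc n)) + (fromℤ (+ n) + 1ℚ) * (tail f *ₛ g) n
    ≡⟨ solve 3 (λ a b c → a :+ (b :+ con 1ℚ) :* c := a :+ (b :* c :+ c))
         refl (f 0 * (s * g (suc n))) (fromℤ (+ n)) ((tail f *ₛ g) n) ⟩
  f 0 * (s * g (suc n)) + (θ (tail f *ₛ g) n + (tail f *ₛ g) n)
    ≡⟨ cong (λ z → f 0 * (s * g (suc n)) + (z + (tail f *ₛ g) n)) (θ-*ₛ (tail f) g n) ⟩
  f 0 * (s * g (suc n)) + ((θ (tail f) *ₛ g) n + (tail f *ₛ θ g) n + (tail f *ₛ g) n)
    -- The term `0ℚ * f 0 * g (suc n)` is inserted as the contribution of the constant coefficient
    -- of `θ f`, so that `θ f *ₛ g` can be folded up again.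
    ≡⟨ solve 6 (λ a x y z f₀ g₁ → a :+ (x :+ y :+ z) := con 0ℚ :* f₀ :* g₁ :+ (x :+ z) :+ (a :+ y)) refl
         (f 0 * (s * g (suc n))) ((θ (tail f) *ₛ g) n) ((tail f *ₛ θ g) n) ((tail f *ₛ g) n) (f 0) (g (suc n)) ⟩
  0ℚ * f 0 * g (suc n) + ((θ (tail f) *ₛ g) n + (tail f *ₛ g) n) + (f 0 * (s * g (suc n)) + (tail f *ₛ θ g) n)
    ≡⟨ cong (λ z → 0ℚ * f 0 * g (suc n) + z + (f 0 * (s * g (suc n)) + (tail f *ₛ θ g) n))
      (trans (sym (*ₛ-distribʳ g (θ (tail f)) (tail f) n)) (*ₛ-congʳ g (λ k → sym (tail-θ f k)) n)) ⟩
  (θ f *ₛ g +ₛ f *ₛ θ g) (suc n) ∎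
  where
  s = fromℤ (+ suc n)

θ-^ₛ : ∀ f m → θ (f ^ₛ suc m) ≗ fromℤ (+ suc m) ·ₛ (f ^ₛ m *ₛ θ f)
θ-^ₛ f m n = begin
  θ (f *ₛ f ^ₛ m) n                               ≡⟨ θ-*ₛ f (f ^ₛ m) n ⟩
  (θ f *ₛ f ^ₛ m) n + (f *ₛ θ (f ^ₛ m)) n         ≡⟨ cong₂ _+_ (*ₛ-comm (θ f) (f ^ₛ m) n) (rest m n) ⟩
  (f ^ₛ m *ₛ θ f) n + fromℤ (+ m) * (f ^ₛ m *ₛ θ f) n
    ≡⟨ solve 2 (λ a b → a :+ b :* a := (b :+ con 1ℚ) :* a) refl ((f ^ₛ m *ₛ θ f) n) (fromℤ (+ m)) ⟩
  (fromℤ (+ m) + 1ℚ) * (f ^ₛ m *ₛ θ f) n          ≡⟨ cong (_* (f ^ₛ m *ₛ θ f) n) (fromℕ-suc m) ⟨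
  fromℤ (+ suc m) * (f ^ₛ m *ₛ θ f) n             ∎
  where
  θ1ₛ : ∀ k → θ 1ₛ k ≡ 0ℚ
  θ1ₛ zero    = refl
  θ1ₛ (suc k) = *-zeroʳ (fromℤ (+ suc k))
  -- The additional factor `f` avoids the exponent m - 1, so that m = 0 obeys the same formula.
  rest : ∀ m → f *ₛ θ (f ^ₛ m) ≗ fromℤ (+ m) ·ₛ (f ^ₛ m *ₛ θ f)
  rest zero n = begin
    (f *ₛ θ 1ₛ) n             ≡⟨ *ₛ-comm f (θ 1ₛ) n ⟩
    (θ 1ₛ *ₛ f) n             ≡⟨ *ₛ-zeroˡ f θ1ₛ n ⟩
    0ℚ                        ≡⟨ *-zeroˡ ((1ₛ *ₛ θ f) n) ⟨
    0ℚ * (1ₛ *ₛ θ f) n        ∎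
  rest (suc m) n = begin
    (f *ₛ θ (f ^ₛ suc m)) n                                ≡⟨ *ₛ-congˡ f (θ-^ₛ f m) n ⟩
    (f *ₛ (fromℤ (+ suc m) ·ₛ (f ^ₛ m *ₛ θ f))) n          ≡⟨ *ₛ-·ₛ (fromℤ (+ suc m)) f (f ^ₛ m *ₛ θ f) n ⟩
    fromℤ (+ suc m) * (f *ₛ (f ^ₛ m *ₛ θ f)) n
      ≡⟨ cong (fromℤ (+ suc m) *_) (*ₛ-assoc f (f ^ₛ m) (θ f) n) ⟨
    fromℤ (+ suc m) * (f ^ₛ suc m *ₛ θ f) n                ∎

-- `tail (θ f)` is the derivative of `f`, so this is the differential equation of e^{tx}.
θ-exp : ∀ t → tail (θ (exp t)) ≗ t ·ₛ exp t
θ-exp t n = begin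
  fromℤ (+ suc n) * (t * t ^ℚ n * 1/! (suc n))
    ≡⟨ solve 4 (λ s t x i → s :* (t :* x :* i) := t :* (x :* (s :* i)))
         refl (fromℤ (+ suc n)) t (t ^ℚ n) (1/! (suc n)) ⟩
  t * (t ^ℚ n * (fromℤ (+ suc n) * 1/! (suc n)))
    ≡⟨ cong (λ z → t * (t ^ℚ n * z)) (1/!-suc n) ⟩
  t * exp t n ∎

-- Both sides start with 1 and solve y′ = (s + t) y. This equation determines n + 1 times the next
-- coefficient from the preceding one, and n + 1 is cancelled.
exp-+ : ∀ s t → exp s *ₛ exp t ≗ exp (s + t)
exp-+ s t zero    = refl
exp-+ s t (suc n) = *-cancelʳ-fromℕ (suc n) (begin
  (exp s *ₛ exp t) (suc n) * fromℤ (+ suc n)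
    ≡⟨ *-comm ((exp s *ₛ exp t) (suc n)) (fromℤ (+ suc n)) ⟩
  θ (exp s *ₛ exp t) (suc n)                                         ≡⟨ θ-*ₛ (exp s) (exp t) (suc n) ⟩
  (0ℚ * exp s 0 * exp t (suc n) + (tail (θ (exp s)) *ₛ exp t) n) + (exp s *ₛ θ (exp t)) (suc n)
    ≡⟨ cong₂ _+_ (cong₂ _+_ (*-zeroˡ (exp t (suc n))) (*ₛ-congʳ (exp t) (θ-exp s) n))
      (*ₛ-suc (exp s) (θ (exp t)) n) ⟩
  (0ℚ + ((s ·ₛ exp s) *ₛ exp t) n) + (exp s (suc n) * 0ℚ + (exp s *ₛ tail (θ (exp t))) n)
    ≡⟨ cong₂ (λ x y → (0ℚ + x) + (exp s (suc n) * 0ℚ + y)) (·ₛ-*ₛ s (exp s) (exp t) n)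
      (trans (*ₛ-congˡ (exp s) (θ-exp t) n) (*ₛ-·ₛ t (exp s) (exp t) n)) ⟩
  (0ℚ + s * (exp s *ₛ exp t) n) + (exp s (suc n) * 0ℚ + t * (exp s *ₛ exp t) n)
    ≡⟨ solve 4 (λ s t e x → (con 0ℚ :+ s :* x) :+ (e :* con 0ℚ :+ t :* x) := (s :+ t) :* x)
         refl s t (exp s (suc n)) ((exp s *ₛ exp t) n) ⟩
  (s + t) * (exp s *ₛ exp t) n           ≡⟨ cong ((s + t) *_) (exp-+ s t n) ⟩
  (s + t) * exp (s + t) n                ≡⟨ θ-exp (s + t) n ⟨
  fromℤ (+ suc n) * exp (s + t) (suc n)  ≡⟨ *-comm (fromℤ (+ suc n)) (exp (s + t) (suc n)) ⟩
  exp (s + t) (suc n) * fromℤ (+ suc n)  ∎)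

-- In e^x e^{tx} the constant term 1 of e^x contributes e^{tx}, and the rest of e^x is x f. One
-- factor x is divided out.
[eˣ-1]/x-*ₛ-exp : ∀ t → tail (exp (1ℚ + t)) ≗ tail (exp t) +ₛ [eˣ-1]/x *ₛ exp t
[eˣ-1]/x-*ₛ-exp t n = begin
  exp (1ℚ + t) (suc n)                                ≡⟨ exp-+ 1ℚ t (suc n) ⟨
  1ℚ * exp t (suc n) + ([eˣ-1]/x *ₛ exp t) n
    ≡⟨ cong (_+ ([eˣ-1]/x *ₛ exp t) n) (*-identityˡ (exp t (suc n))) ⟩
  exp t (suc n) + ([eˣ-1]/x *ₛ exp t) n               ∎

-- The preceding identity multiplied by f^j: the difference between 1 + t and t exchanges one x for
-- one more factor f. This is the counterpart of `Δ-powers-suc`.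
[eˣ-1]/x-^ₛ-suc : ∀ j t n →
  ([eˣ-1]/x ^ₛ j *ₛ exp (1ℚ + t)) (suc n) ≡ ([eˣ-1]/x ^ₛ j *ₛ exp t) (suc n) + ([eˣ-1]/x ^ₛ suc j *ₛ exp t) n
[eˣ-1]/x-^ₛ-suc j t n = begin
  (F *ₛ exp (1ℚ + t)) (suc n)                                      ≡⟨ *ₛ-suc F (exp (1ℚ + t)) n ⟩
  F (suc n) * 1ℚ + (F *ₛ tail (exp (1ℚ + t))) n
    ≡⟨ cong (_+_ (F (suc n) * 1ℚ)) (*ₛ-congˡ F ([eˣ-1]/x-*ₛ-exp t) n) ⟩
  F (suc n) * 1ℚ + (F *ₛ (tail (exp t) +ₛ f *ₛ exp t)) n
    ≡⟨ cong (_+_ (F (suc n) * 1ℚ)) (*ₛ-distribˡ F (tail (exp t)) (f *ₛ exp t) n) ⟩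
  F (suc n) * 1ℚ + ((F *ₛ tail (exp t)) n + (F *ₛ (f *ₛ exp t)) n) ≡⟨ +-assoc (F (suc n) * 1ℚ) _ _ ⟨
  F (suc n) * 1ℚ + (F *ₛ tail (exp t)) n + (F *ₛ (f *ₛ exp t)) n
    ≡⟨ cong₂ _+_ (sym (*ₛ-suc F (exp t) n)) (trans (*ₛ-leftComm F f (exp t) n) (sym (*ₛ-assoc f F (exp t) n))) ⟩
  (F *ₛ exp t) (suc n) + (f *ₛ F *ₛ exp t) n                       ∎
  where
  f = [eˣ-1]/x
  F = f ^ₛ j

^ₛ-zero : ∀ {f} → f 0 ≡ 1ℚ → ∀ m → (f ^ₛ m) 0 ≡ 1ℚ
^ₛ-zero f0≡1 zero    = refl
^ₛ-zero f0≡1 (suc m) = cong₂ (λ x y → x * y + 0ℚ) f0≡1 (^ₛ-zero f0≡1 m)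

-- Finite differences

-- For k > j the exponent is truncated to 0, but there the binomial coefficient vanishes.
signedC : ℕ → ℕ → ℤ
signedC j k = + (j C k) ℤ.* -1ℤ ^ (j ∸ k)

-- The j-th forward difference of `g` at 0. Each summand is formed in ℤ, so that
-- `Δ n₀ (powers (ℤ.- r) n₁)` unfolds to the sum in the first case of the theorem.
Δ : ℕ → (ℕ → ℤ) → ℚ
Δ j g = ∑[ k ≤ j ] fromℤ (signedC j (toℕ k) ℤ.* g (toℕ k))

-- Pascal's rule with signs. Lowering the exponent by one flips the sign only for k < j; otherwise
-- `j C suc k` is 0, and the truncated exponent does no harm.
signedC-suc : ∀ j k → signedC (suc j) (suc k) ≡ signedC j k ℤ.- signedC j (suc k)
signedC-suc j k with k ℕ.<? j
... | yes k<j = begin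
  + (suc j C suc k) ℤ.* s                              ≡⟨ cong (λ c → + c ℤ.* s) (nCk+nC[k+1]≡[n+1]C[k+1] j k) ⟨
  (+ (j C k) ℤ.+ + (j C suc k)) ℤ.* s                  ≡⟨ cong ((+ (j C k) ℤ.+ + (j C suc k)) ℤ.*_) s≡-s′ ⟩
  (+ (j C k) ℤ.+ + (j C suc k)) ℤ.* (-1ℤ ℤ.* s′)
    ≡⟨ ℤS.solve 3 (λ a b s → (a ℤS.:+ b) ℤS.:* (ℤS.con -1ℤ ℤS.:* s) ℤS.:= a ℤS.:* (ℤS.con -1ℤ ℤS.:* s) ℤS.:- b ℤS.:* s)
         refl (+ (j C k)) (+ (j C suc k)) s′ ⟩
  + (j C k) ℤ.* (-1ℤ ℤ.* s′) ℤ.- + (j C suc k) ℤ.* s′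
    ≡⟨ cong (λ z → + (j C k) ℤ.* z ℤ.- + (j C suc k) ℤ.* s′) s≡-s′ ⟨
  + (j C k) ℤ.* s ℤ.- + (j C suc k) ℤ.* s′             ∎
  where
  s = -1ℤ ^ (j ∸ k)
  s′ = -1ℤ ^ (j ∸ suc k)
  s≡-s′ : s ≡ -1ℤ ℤ.* s′
  s≡-s′ = cong (-1ℤ ^_) (ℕ.+-∸-assoc 1 k<j)
... | no k≮j = begin
  + (suc j C suc k) ℤ.* s                              ≡⟨ cong (λ c → + c ℤ.* s) (nCk+nC[k+1]≡[n+1]C[k+1] j k) ⟨
  + (j C k ℕ.+ j C suc k) ℤ.* s                        ≡⟨ cong (λ c → + (j C k ℕ.+ c) ℤ.* s) c≡0 ⟩
  + (j C k ℕ.+ 0) ℤ.* s                                ≡⟨ cong (λ c → + c ℤ.* s) (ℕ.+-identityʳ (j C k)) ⟩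
  + (j C k) ℤ.* s                                      ≡⟨ ℤ.+-identityʳ _ ⟨
  + (j C k) ℤ.* s ℤ.- + 0 ℤ.* s′                       ≡⟨ cong (λ c → + (j C k) ℤ.* s ℤ.- + c ℤ.* s′) c≡0 ⟨
  + (j C k) ℤ.* s ℤ.- + (j C suc k) ℤ.* s′             ∎
  where
  s = -1ℤ ^ (j ∸ k)
  s′ = -1ℤ ^ (j ∸ suc k)
  c≡0 : j C suc k ≡ 0
  c≡0 = k>n⇒nCk≡0 (s≤s (ℕ.≮⇒≥ k≮j))

∑-last : ∀ n (h : ℕ → ℚ) → ∑[ k ≤ suc n ] h (toℕ k) ≡ ∑[ k ≤ n ] h (toℕ k) + h (suc n)
∑-last zero    h = solve 2 (λ a b → a :+ (b :+ con 0ℚ) := a :+ con 0ℚ :+ b) refl (h 0) (h 1)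
∑-last (suc n) h = trans (cong (_+_ (h 0)) (∑-last n (λ k → h (suc k)))) (sym (+-assoc (h 0) _ _))

∑-- : ∀ n (g h : ℕ → ℚ) → ∑[ k ≤ n ] (g (toℕ k) - h (toℕ k)) ≡ ∑[ k ≤ n ] g (toℕ k) - ∑[ k ≤ n ] h (toℕ k)
∑-- zero    g h = solve 2 (λ a b → a :- b :+ con 0ℚ := a :+ con 0ℚ :- (b :+ con 0ℚ)) refl (g 0) (h 0)
∑-- (suc n) g h = trans (cong (_+_ (g 0 - h 0)) (∑-- n (λ k → g (suc k)) (λ k → h (suc k))))
  (solve 4 (λ a b c d → a :- b :+ (c :- d) := a :+ c :- (b :+ d)) refl (g 0) (h 0) _ _)

-- Pascal's rule gives two sums. The one with `signedC j (suc k)` lacks the term of index 0, which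
-- the head of the left side provides, and has a surplus term of index j + 1, which vanishes.
Δ-suc : ∀ j g → Δ (suc j) g ≡ Δ j (λ k → g (suc k)) - Δ j g
Δ-suc j g = begin
  Δ (suc j) g
    ≡⟨ cong₂ _+_ head≡ (trans (sum-cong-≗ {suc j} (λ k → tail≡ (toℕ k))) (∑-- j g↑ (λ k → h (suc k)))) ⟩
  - h 0 + (Δ j (λ k → g (suc k)) - ∑[ k ≤ j ] h (suc (toℕ k)))
    ≡⟨ solve 3 (λ a b c → :- a :+ (b :- c) := b :- (a :+ c))
         refl (h 0) (Δ j (λ k → g (suc k))) (∑[ k ≤ j ] h (suc (toℕ k))) ⟩
  Δ j (λ k → g (suc k)) - ∑[ k ≤ suc j ] h (toℕ k)
    ≡⟨ cong (λ z → Δ j (λ k → g (suc k)) - z)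
      (trans (∑-last j h) (trans (cong (_+_ (Δ j g)) hlast≡0) (+-identityʳ (Δ j g)))) ⟩
  Δ j (λ k → g (suc k)) - Δ j g ∎
  where
  h g↑ : ℕ → ℚ
  h k = fromℤ (signedC j k ℤ.* g k)
  g↑ k = fromℤ (signedC j k ℤ.* g (suc k))
  head≡ : fromℤ (signedC (suc j) 0 ℤ.* g 0) ≡ - h 0
  head≡ =
    trans (cong fromℤ (ℤS.solve 2 (λ s x → ℤS.con 1ℤ ℤS.:* (ℤS.con -1ℤ ℤS.:* s) ℤS.:* x ℤS.:= ℤS.:- (ℤS.con 1ℤ ℤS.:* s ℤS.:* x))
         refl (-1ℤ ^ j) (g 0))) (fromℤ-neg (signedC j 0 ℤ.* g 0))
  tail≡ : ∀ k → fromℤ (signedC (suc j) (suc k) ℤ.* g (suc k)) ≡ g↑ k - h (suc k)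
  tail≡ k = trans (cong fromℤ (trans (cong (ℤ._* g (suc k)) (signedC-suc j k))
    (ℤS.solve 3 (λ a b c → (a ℤS.:- b) ℤS.:* c ℤS.:= a ℤS.:* c ℤS.:- b ℤS.:* c)
         refl (signedC j k) (signedC j (suc k)) (g (suc k)))))
    (fromℤ-- (signedC j k ℤ.* g (suc k)) (signedC j (suc k) ℤ.* g (suc k)))
  hlast≡0 : h (suc j) ≡ 0ℚ
  hlast≡0 = cong (λ c → fromℤ (+ c ℤ.* -1ℤ ^ (j ∸ suc j) ℤ.* g (suc j))) (k>n⇒nCk≡0 (ℕ.n<1+n j))

Δ-cong : ∀ j {g h} → g ≗ h → Δ j g ≡ Δ j h
Δ-cong j g≗h = sum-cong-≗ {suc j} (λ k → cong (λ x → fromℤ (signedC j (toℕ k) ℤ.* x)) (g≗h (toℕ k)))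

powers : ℤ → ℕ → ℕ → ℤ
powers t N k = (+ k ℤ.+ t) ^ N

powers-suc : ∀ t N k → powers t N (suc k) ≡ powers (1ℤ ℤ.+ t) N k
powers-suc t N k =
  cong (_^ N) (ℤS.solve 2 (λ k t → (ℤS.con 1ℤ ℤS.:+ k) ℤS.:+ t ℤS.:= k ℤS.:+ (ℤS.con 1ℤ ℤS.:+ t)) refl (+ k) t)

Δ-powers-suc : ∀ j t N → Δ (suc j) (powers t N) ≡ Δ j (powers (1ℤ ℤ.+ t) N) - Δ j (powers t N)
Δ-powers-suc j t N = trans (Δ-suc j (powers t N)) (cong (_- Δ j (powers t N)) (Δ-cong j (powers-suc t N)))

-- Both sides are the coefficient of xᴺ in (eˣ - 1)ʲ eᵗˣ = xʲ fʲ eᵗˣ.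
Δ-powers : ∀ j t n {N} → n ℕ.+ j ≡ N → Δ j (powers t N) * 1/! N ≡ ([eˣ-1]/x ^ₛ j *ₛ exp (fromℤ t)) n
Δ-powers zero t n {N} n+0≡N = begin
  (fromℤ (1ℤ ℤ.* (+ 0 ℤ.+ t) ^ N) + 0ℚ) * 1/! N
    ≡⟨ cong (_* 1/! N) (+-identityʳ (fromℤ (1ℤ ℤ.* (+ 0 ℤ.+ t) ^ N))) ⟩
  fromℤ (1ℤ ℤ.* (+ 0 ℤ.+ t) ^ N) * 1/! N
    ≡⟨ cong (λ z → fromℤ z * 1/! N) (trans (ℤ.*-identityˡ ((+ 0 ℤ.+ t) ^ N)) (cong (_^ N) (ℤ.+-identityˡ t))) ⟩
  fromℤ (t ^ N) * 1/! N                          ≡⟨ cong (_* 1/! N) (fromℤ-^ t N) ⟩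
  exp (fromℤ t) N                                ≡⟨ cong (exp (fromℤ t)) (trans (sym n+0≡N) (ℕ.+-identityʳ n)) ⟩
  exp (fromℤ t) n                                ≡⟨ *ₛ-identityˡ (exp (fromℤ t)) n ⟨
  (1ₛ *ₛ exp (fromℤ t)) n                        ∎
Δ-powers (suc j) t n {N} n+1+j≡N = begin
  Δ (suc j) (powers t N) * 1/! N                                ≡⟨ cong (_* 1/! N) (Δ-powers-suc j t N) ⟩
  (Δ j (powers (1ℤ ℤ.+ t) N) - Δ j (powers t N)) * 1/! N
    ≡⟨ solve 3 (λ a b c → (a :- b) :* c := a :* c :- b :* c)
         refl (Δ j (powers (1ℤ ℤ.+ t) N)) (Δ j (powers t N)) (1/! N) ⟩
  Δ j (powers (1ℤ ℤ.+ t) N) * 1/! N - Δ j (powers t N) * 1/! N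
    -- Lowering j while raising n keeps N = n + j, hence the same powers and the same factorial.
    ≡⟨ cong₂ _-_ (Δ-powers j (1ℤ ℤ.+ t) (suc n) 1+n+j≡N) (Δ-powers j t (suc n) 1+n+j≡N) ⟩
  H (fromℤ (1ℤ ℤ.+ t)) - H (fromℤ t)
    ≡⟨ cong (λ z → H z - H (fromℤ t)) (fromℤ-+ 1ℤ t) ⟩
  H (1ℚ + fromℤ t) - H (fromℤ t)
    ≡⟨ cong (_- H (fromℤ t)) ([eˣ-1]/x-^ₛ-suc j (fromℤ t) n) ⟩
  (H (fromℤ t) + K) - H (fromℤ t)
    ≡⟨ solve 2 (λ a b → (a :+ b) :- a := b) refl (H (fromℤ t)) K ⟩
  K                                                             ∎
  where
  1+n+j≡N : suc n ℕ.+ j ≡ N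
  1+n+j≡N = trans (sym (ℕ.+-suc n j)) n+1+j≡N
  H : ℚ → ℚ
  H s = ([eˣ-1]/x ^ₛ j *ₛ exp s) (suc n)
  K = ([eˣ-1]/x ^ₛ suc j *ₛ exp (fromℤ t)) n

-- Induction on the order j + 1. For N < j both differences of order j vanish. For N = j they equal
-- j! for every shift, because f^j e^{sx} has constant term 1; so their difference is 0.
Δ-powers-< : ∀ j t N → N < j → Δ j (powers t N) ≡ 0ℚ
Δ-powers-< (suc j) t N (s≤s N≤j) = trans (Δ-powers-suc j t N) (lemma (ℕ.m≤n⇒m<n∨m≡n N≤j))
  where
  F = [eˣ-1]/x ^ₛ j
  constant : ∀ s → Δ j (powers s j) * 1/! j ≡ 1ℚ
  constant s =
    trans (Δ-powers j s 0 refl) (trans (+-identityʳ (F 0 * 1ℚ)) (trans (*-identityʳ (F 0)) (^ₛ-zero refl j)))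
  lemma : N < j ⊎ N ≡ j → Δ j (powers (1ℤ ℤ.+ t) N) - Δ j (powers t N) ≡ 0ℚ
  lemma (inj₁ N<j)  = cong₂ _-_ (Δ-powers-< j (1ℤ ℤ.+ t) N N<j) (Δ-powers-< j t N N<j)
  lemma (inj₂ refl) = trans (cong (_- Δ j (powers t j))
    (*-cancelʳ-unit {Δ j (powers (1ℤ ℤ.+ t) j)} {Δ j (powers t j)} (fromℤ (+ (j !))) (1/! j) (1/!*! j)
      (trans (constant (1ℤ ℤ.+ t)) (sym (constant t)))))
    (+-inverseʳ (Δ j (powers t j)))

-- Denominators in lowest terms

*-swap-denominators : ∀ {x a d} → x * fromℤ (+ d) ≡ fromℤ a → ↥ x ℤ.* + d ≡ a ℤ.* ↧ x
*-swap-denominators {x} {a} {d} xd≡a = cong ↥_ (begin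
  fromℤ (↥ x ℤ.* + d)              ≡⟨ fromℤ-* (↥ x) (+ d) ⟩
  fromℤ (↥ x) * fromℤ (+ d)        ≡⟨ cong (_* fromℤ (+ d)) x*↧≡↥ ⟨
  x * fromℤ (↧ x) * fromℤ (+ d)
    ≡⟨ solve 3 (λ x e d → x :* e :* d := x :* d :* e) refl x (fromℤ (↧ x)) (fromℤ (+ d)) ⟩
  x * fromℤ (+ d) * fromℤ (↧ x)    ≡⟨ cong (_* fromℤ (↧ x)) xd≡a ⟩
  fromℤ a * fromℤ (↧ x)            ≡⟨ fromℤ-* a (↧ x) ⟨
  fromℤ (a ℤ.* ↧ x)                ∎)
  where
  x*↧≡↥ : x * fromℤ (↧ x) ≡ fromℤ (↥ x)
  x*↧≡↥ = trans (cong (_* fromℤ (↧ x)) (sym (↥p/↧p≡p x))) (/*↧ (↥ x) (↧ₙ x))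

-- The reduced denominator divides `↥ x` times d by cross-multiplication, and it is coprime to
-- `↥ x`.
↧∣ : ∀ {x a d} → x * fromℤ (+ d) ≡ fromℤ a → ↧ₙ x ∣ d
↧∣ {x@(mkℚ _ _ coprime)} {a} {d} xd≡a = coprime-divisor (Coprime.sym (Coprime.recompute coprime))
  (divides ℤ.∣ a ∣ (trans (sym (ℤ.abs-* (↥ x) (+ d)))
    (trans (cong ℤ.∣_∣ (*-swap-denominators {x} {a} {d} xd≡a)) (ℤ.abs-* a (↧ x)))))

-- Prepares Fermat's theorem with N = p: the two end terms of the coefficient of x^N in e^x e^{tx}
-- carry 1/N!, while the terms in between involve only factorials of smaller numbers.
exp-1+-ends : ∀ t n {N} → N ≡ 2 ℕ.+ n → exp (1ℚ + t) N ≡ exp t N + exp 1ℚ N + (tail (exp 1ℚ) *ₛ tail (exp t)) n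
exp-1+-ends t n refl = begin
  exp (1ℚ + t) (2 ℕ.+ n)                                                     ≡⟨ [eˣ-1]/x-*ₛ-exp t (suc n) ⟩
  exp t (2 ℕ.+ n) + ([eˣ-1]/x *ₛ exp t) (suc n)
    ≡⟨ cong (_+_ (exp t (2 ℕ.+ n))) (*ₛ-suc [eˣ-1]/x (exp t) n) ⟩
  exp t (2 ℕ.+ n) + (exp 1ℚ (2 ℕ.+ n) * 1ℚ + ([eˣ-1]/x *ₛ tail (exp t)) n)
    ≡⟨ solve 3 (λ a b c → a :+ (b :* con 1ℚ :+ c) := a :+ b :+ c)
         refl (exp t (2 ℕ.+ n)) (exp 1ℚ (2 ℕ.+ n)) (([eˣ-1]/x *ₛ tail (exp t)) n) ⟩
  exp t (2 ℕ.+ n) + exp 1ℚ (2 ℕ.+ n) + ([eˣ-1]/x *ₛ tail (exp t)) n          ∎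

exp*! : ∀ t n → exp t n * fromℤ (+ (n !)) ≡ t ^ℚ n
exp*! t n =
  trans (*-assoc (t ^ℚ n) (1/! n) (fromℤ (+ (n !)))) (trans (cong (t ^ℚ n *_) (1/!*! n)) (*-identityʳ (t ^ℚ n)))

1^ℚ : ∀ n → 1ℚ ^ℚ n ≡ 1ℚ
1^ℚ zero    = refl
1^ℚ (suc n) = trans (*-identityˡ (1ℚ ^ℚ n)) (1^ℚ n)

-- Factorials, signs and binomial sums

fac sgn : ℕ → ℚ
fac n = fromℤ (+ (n !))
sgn n = fromℤ (-1ℤ ^ n)

-1^n*-1^n≡1 : ∀ n → -1ℤ ^ n ℤ.* -1ℤ ^ n ≡ 1ℤ
-1^n*-1^n≡1 zero    = refl
-1^n*-1^n≡1 (suc n) =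
  trans (ℤS.solve 1 (λ x → (ℤS.con -1ℤ ℤS.:* x) ℤS.:* (ℤS.con -1ℤ ℤS.:* x) ℤS.:= x ℤS.:* x)
       refl (-1ℤ ^ n)) (-1^n*-1^n≡1 n)

sgn*sgn : ∀ n → sgn n * sgn n ≡ 1ℚ
sgn*sgn n = trans (sym (fromℤ-* (-1ℤ ^ n) (-1ℤ ^ n))) (cong fromℤ (-1^n*-1^n≡1 n))

sgn-suc : ∀ n → sgn (suc n) ≡ - sgn n
sgn-suc n = trans (cong fromℤ (ℤ.-1*i≡-i (-1ℤ ^ n))) (fromℤ-neg (-1ℤ ^ n))

sgn-+ : ∀ m n → sgn (m ℕ.+ n) ≡ sgn m * sgn n
sgn-+ m n = trans (cong fromℤ (ℤ.^-distribˡ-+-* -1ℤ m n)) (fromℤ-* (-1ℤ ^ m) (-1ℤ ^ n))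

-- Inserting the square of (-1)^k turns (-1)^(j-k) into (-1)^j (-1)^k. This passes from the signs of
-- the difference to those of the cases n₀ > n₁.
signedC-sgn : ∀ j k → signedC j k ≡ -1ℤ ^ j ℤ.* (+ (j C k) ℤ.* -1ℤ ^ k)
signedC-sgn j k with k ℕ.≤? j
... | yes k≤j = begin
  c ℤ.* s                    ≡⟨ ℤ.*-identityʳ (c ℤ.* s) ⟨
  c ℤ.* s ℤ.* 1ℤ             ≡⟨ cong (c ℤ.* s ℤ.*_) (-1^n*-1^n≡1 k) ⟨
  c ℤ.* s ℤ.* (e ℤ.* e)
    ≡⟨ ℤS.solve 3 (λ c s e → c ℤS.:* s ℤS.:* (e ℤS.:* e) ℤS.:= (s ℤS.:* e) ℤS.:* (c ℤS.:* e)) refl c s e ⟩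
  (s ℤ.* e) ℤ.* (c ℤ.* e)    ≡⟨ cong (ℤ._* (c ℤ.* e)) (ℤ.^-distribˡ-+-* -1ℤ (j ∸ k) k) ⟨
  -1ℤ ^ (j ∸ k ℕ.+ k) ℤ.* (c ℤ.* e) ≡⟨ cong (λ i → -1ℤ ^ i ℤ.* (c ℤ.* e)) (ℕ.m∸n+n≡m k≤j) ⟩
  -1ℤ ^ j ℤ.* (c ℤ.* e)      ∎
  where
  c = + (j C k)
  s = -1ℤ ^ (j ∸ k)
  e = -1ℤ ^ k
... | no k≰j = begin
  + (j C k) ℤ.* -1ℤ ^ (j ∸ k)              ≡⟨ cong (λ c → + c ℤ.* -1ℤ ^ (j ∸ k)) c≡0 ⟩
  + 0                                      ≡⟨ ℤ.*-zeroʳ (-1ℤ ^ j) ⟨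
  -1ℤ ^ j ℤ.* (+ 0 ℤ.* -1ℤ ^ k)            ≡⟨ cong (λ c → -1ℤ ^ j ℤ.* (+ c ℤ.* -1ℤ ^ k)) c≡0 ⟨
  -1ℤ ^ j ℤ.* (+ (j C k) ℤ.* -1ℤ ^ k)      ∎
  where
  c≡0 : j C k ≡ 0
  c≡0 = k>n⇒nCk≡0 (ℕ.≰⇒> k≰j)

∑-*ˡ : ∀ c n (h : ℕ → ℚ) → ∑[ k ≤ n ] (c * h (toℕ k)) ≡ c * ∑[ k ≤ n ] h (toℕ k)
∑-*ˡ c zero    h = solve 2 (λ c x → c :* x :+ con 0ℚ := c :* (x :+ con 0ℚ)) refl c (h 0)
∑-*ˡ c (suc n) h = trans (cong (_+_ (c * h 0)) (∑-*ˡ c n (λ k → h (suc k)))) (sym (*-distribˡ-+ c (h 0) _))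

[-1]^ᶻ[n-1] : ∀ n → (- 1ℚ) ^ᶻ (+ n ℤ.- 1ℤ) ≡ - sgn n
-- The exponent is -1 here; this occurs when p divides r.
[-1]^ᶻ[n-1] zero    = refl
[-1]^ᶻ[n-1] (suc n) = begin
  (- 1ℚ) ^ℚ n          ≡⟨ fromℤ-^ -1ℤ n ⟨
  sgn n                ≡⟨ solve 1 (λ x → x := :- (:- x)) refl (sgn n) ⟩
  - (- sgn n)          ≡⟨ cong -_ (sgn-suc n) ⟨
  - sgn (suc n)        ∎

nPk*[n∸k]!≡n! : ∀ {n k} → k ≤ n → (n P k) ℕ.* (n ∸ k) ! ≡ n !
nPk*[n∸k]!≡n! {n} {k} k≤n =
  trans (cong (ℕ._* (n ∸ k) !) (nPk≡n!/[n∸k]! k≤n)) (m/n*n≡m (m≤n⇒m!∣n! (ℕ.m∸n≤m n k)))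
  where instance _ = (n ∸ k) !≢0

[n∸k]!/n!≡1/nPk : ∀ {n k} (k≤n : k ≤ n) → fac (n ∸ k) * 1/! n ≡ (1ℤ / (n P k)) {{nPk≢0 k≤n}}
[n∸k]!/n!≡1/nPk {n} {k} k≤n = *-cancelʳ-fromℕ (n P k) {{nPk≢0 k≤n}} (begin
  fac (n ∸ k) * 1/! n * fromℤ (+ (n P k))
    ≡⟨ solve 3 (λ a b c → a :* b :* c := b :* (c :* a)) refl (fac (n ∸ k)) (1/! n) (fromℤ (+ (n P k))) ⟩
  1/! n * (fromℤ (+ (n P k)) * fac (n ∸ k))
    ≡⟨ cong (1/! n *_) (trans (cong fromℤ (ℤ.pos-* (n P k) ((n ∸ k) !)))
      (fromℤ-* (+ (n P k)) (+ ((n ∸ k) !)))) ⟨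
  1/! n * fromℤ (+ ((n P k) ℕ.* (n ∸ k) !))         ≡⟨ cong (λ m → 1/! n * fromℤ (+ m)) (nPk*[n∸k]!≡n! k≤n) ⟩
  1/! n * fac n                                   ≡⟨ 1/!*! n ⟩
  1ℚ                                              ≡⟨ 1/*↧ (n P k) {{nPk≢0 k≤n}} ⟨
  (1ℤ / (n P k)) {{nPk≢0 k≤n}} * fromℤ (+ (n P k)) ∎)

fromℕ-+ : ∀ m n → fromℤ (+ (m ℕ.+ n)) ≡ fromℤ (+ m) + fromℤ (+ n)
fromℕ-+ m n = fromℤ-+ (+ m) (+ n)

fromℕ-* : ∀ m n → fromℤ (+ (m ℕ.* n)) ≡ fromℤ (+ m) * fromℤ (+ n)
fromℕ-* m n = trans (cong fromℤ (ℤ.pos-* m n)) (fromℤ-* (+ m) (+ n))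

∣m⊖n∣<p : ∀ {m n p} → m < p → n < p → ℤ.∣ m ℤ.⊖ n ∣ < p
∣m⊖n∣<p {m} {n} m<p n<p = ℕ.≤-<-trans (ℤ.∣m⊝n∣≤m⊔n m n) (ℕ.⊔-lub m<p n<p)

∣m⊖n∣≡0⇒m≡n : ∀ {m n} → ℤ.∣ m ℤ.⊖ n ∣ ≡ 0 → m ≡ n
∣m⊖n∣≡0⇒m≡n {m} {n} eq = ℤ.+-injective (ℤ.i-j≡0⇒i≡j (+ m) (+ n) (trans (ℤ.m-n≡m⊖n m n) (ℤ.∣i∣≡0⇒i≡0 eq)))

-- What is subtracted is zero by `Δ-powers-<`; doing so term by term produces differences of powers
-- to which Fermat applies. It is used with M = 0 and with M = n₁.
Δ-difference : ∀ j t N {M} → M < j →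
  Δ j (powers t N)
    ≡ ∑[ k ≤ j ] (fromℤ (signedC j (toℕ k) ℤ.* powers t N (toℕ k)) - fromℤ (signedC j (toℕ k) ℤ.* powers t M (toℕ k)))
Δ-difference j t N {M} M<j = begin
  Δ j (powers t N)                                                    ≡⟨ +-identityʳ (Δ j (powers t N)) ⟨
  Δ j (powers t N) - 0ℚ
    ≡⟨ cong (_-_ (Δ j (powers t N))) (Δ-powers-< j t M M<j) ⟨
  Δ j (powers t N) - Δ j (powers t M)
    ≡⟨ ∑-- j (λ k → fromℤ (signedC j k ℤ.* powers t N k)) (λ k → fromℤ (signedC j k ℤ.* powers t M k)) ⟨
  ∑[ k ≤ j ] (fromℤ (signedC j (toℕ k) ℤ.* powers t N (toℕ k)) - fromℤ (signedC j (toℕ k) ℤ.* powers t M (toℕ k))) ∎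

-- The localisation of ℤ at p and its maximal ideal

module Localisation {p : ℕ} (p-prime : Prime p) where

  private
    instance
      p≢0 : ℕ.NonZero p
      p≢0 = prime⇒nonZero p-prime

  1<p : 1 < p
  1<p = ℕ.nonTrivial⇒n>1 p {{prime⇒nonTrivial p-prime}}

  p∤1 : ¬ p ∣ 1
  p∤1 p∣1 = ¬prime[1] (subst Prime (∣1⇒≡1 p∣1) p-prime)

  p∤* : ∀ m n → ¬ p ∣ m → ¬ p ∣ n → ¬ p ∣ m ℕ.* n
  p∤* m n p∤m p∤n = [ p∤m , p∤n ]′ ∘ euclidsLemma m n p-prime

  p∤n : ∀ n .{{_ : ℕ.NonZero n}} → n < p → ¬ p ∣ n
  p∤n n n<p p∣n = ℕ.<⇒≱ n<p (∣⇒≤ p∣n)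

  p∤! : ∀ n → n < p → ¬ p ∣ n !
  p∤! zero    _   = p∤1
  p∤! (suc n) n<p = p∤* (suc n) (n !) (p∤n (suc n) n<p) (p∤! n (ℕ.<-trans (ℕ.n<1+n n) n<p))

  -- Unlike in _∈ℤₚ[_], the fraction num / den need not be in lowest terms.
  record Integral (x : ℚ) : Set where
    constructor integral
    field
      {den}   : ℕ
      {num}   : ℤ
      p∤den   : ¬ p ∣ den
      *den    : x * fromℤ (+ den) ≡ fromℤ num

  integral⇒∈ℤₚ : ∀ {x} → Integral x → x ∈ℤₚ[ p ]
  integral⇒∈ℤₚ {x} (integral {d} {a} p∤d xd≡a) p∣↧ = p∤d (∣-trans p∣↧ (↧∣ {x} {a} {d} xd≡a))

  integral-fromℤ : ∀ a → Integral (fromℤ a)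
  integral-fromℤ a = integral {den = 1} p∤1 (*-identityʳ (fromℤ a))

  integral-0 : Integral 0ℚ
  integral-0 = integral-fromℤ (+ 0)

  integral-1 : Integral 1ℚ
  integral-1 = integral-fromℤ 1ℤ

  integral-* : ∀ {x y} → Integral x → Integral y → Integral (x * y)
  integral-* {x} {y} (integral {d} {a} p∤d xd≡a) (integral {e} {b} p∤e ye≡b) =
    integral {num = a ℤ.* b} (p∤* d e p∤d p∤e) (begin
      x * y * fromℤ (+ (d ℕ.* e))
        ≡⟨ cong (x * y *_) (trans (cong fromℤ (ℤ.pos-* d e)) (fromℤ-* (+ d) (+ e))) ⟩
      x * y * (fromℤ (+ d) * fromℤ (+ e))
        ≡⟨ solve 4 (λ x y d e → x :* y :* (d :* e) := x :* d :* (y :* e)) refl x y (fromℤ (+ d)) (fromℤ (+ e)) ⟩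
      x * fromℤ (+ d) * (y * fromℤ (+ e))       ≡⟨ cong₂ _*_ xd≡a ye≡b ⟩
      fromℤ a * fromℤ b                         ≡⟨ fromℤ-* a b ⟨
      fromℤ (a ℤ.* b)                           ∎)

  integral-+ : ∀ {x y} → Integral x → Integral y → Integral (x + y)
  integral-+ {x} {y} (integral {d} {a} p∤d xd≡a) (integral {e} {b} p∤e ye≡b) =
    integral {num = a ℤ.* + e ℤ.+ b ℤ.* + d} (p∤* d e p∤d p∤e) (begin
      (x + y) * fromℤ (+ (d ℕ.* e))
        ≡⟨ cong ((x + y) *_) (trans (cong fromℤ (ℤ.pos-* d e)) (fromℤ-* (+ d) (+ e))) ⟩
      (x + y) * (fromℤ (+ d) * fromℤ (+ e))
        ≡⟨ solve 4 (λ x y d e → (x :+ y) :* (d :* e) := x :* d :* e :+ y :* e :* d)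
             refl x y (fromℤ (+ d)) (fromℤ (+ e)) ⟩
      x * fromℤ (+ d) * fromℤ (+ e) + y * fromℤ (+ e) * fromℤ (+ d)
        ≡⟨ cong₂ (λ u v → u * fromℤ (+ e) + v * fromℤ (+ d)) xd≡a ye≡b ⟩
      fromℤ a * fromℤ (+ e) + fromℤ b * fromℤ (+ d)
        ≡⟨ cong₂ _+_ (fromℤ-* a (+ e)) (fromℤ-* b (+ d)) ⟨
      fromℤ (a ℤ.* + e) + fromℤ (b ℤ.* + d)     ≡⟨ fromℤ-+ (a ℤ.* + e) (b ℤ.* + d) ⟨
      fromℤ (a ℤ.* + e ℤ.+ b ℤ.* + d)           ∎)

  integral-neg : ∀ {x} → Integral x → Integral (- x)
  integral-neg {x} int-x =
    subst Integral (solve 1 (λ x → con (fromℤ -1ℤ) :* x := :- x) refl x) (integral-* (integral-fromℤ -1ℤ) int-x)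

  integral-- : ∀ {x y} → Integral x → Integral y → Integral (x - y)
  integral-- int-x int-y = integral-+ int-x (integral-neg int-y)

  integral-^ : ∀ {x} n → Integral x → Integral (x ^ℚ n)
  integral-^ zero    int-x = integral-1
  integral-^ (suc n) int-x = integral-* int-x (integral-^ n int-x)

  integral-1/ : ∀ d .{{_ : ℕ.NonZero d}} → ¬ p ∣ d → Integral (1ℤ / d)
  integral-1/ d p∤d = integral {num = 1ℤ} p∤d (1/*↧ d)

  integral-1/! : ∀ n → n < p → Integral (1/! n)
  integral-1/! n n<p = integral-1/ (n !) {{n !≢0}} (p∤! n n<p)

  integral-∑ : ∀ n (h : ℕ → ℚ) → (∀ k → k ≤ n → Integral (h k)) → Integral (∑[ k ≤ n ] h (toℕ k))
  integral-∑ zero    h int-h = integral-+ (int-h 0 z≤n) integral-0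
  integral-∑ (suc n) h int-h =
    integral-+ (int-h 0 z≤n) (integral-∑ n (λ k → h (suc k)) (λ k k≤n → int-h (suc k) (s≤s k≤n)))

  -- Integrality holds only on an initial segment: the coefficients of `exp` and `[eˣ-1]/x` have
  -- factorials as denominators, and p divides these from p! on.
  IntegralUpTo : ℕ → PowerSeries → Set
  IntegralUpTo n f = ∀ k → k ≤ n → Integral (f k)

  integral-*ₛ : ∀ n f g → IntegralUpTo n f → IntegralUpTo n g → Integral ((f *ₛ g) n)
  integral-*ₛ n f g int-f int-g =
    integral-∑ n (λ k → f k * g (n ∸ k)) (λ k k≤n → integral-* (int-f k k≤n) (int-g (n ∸ k) (ℕ.m∸n≤m n k)))

  integralUpTo-*ₛ : ∀ n f g → IntegralUpTo n f → IntegralUpTo n g → IntegralUpTo n (f *ₛ g)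
  integralUpTo-*ₛ n f g int-f int-g k k≤n =
    integral-*ₛ k f g (λ i i≤k → int-f i (ℕ.≤-trans i≤k k≤n)) (λ i i≤k → int-g i (ℕ.≤-trans i≤k k≤n))

  integral-1ₛ : ∀ n → IntegralUpTo n 1ₛ
  integral-1ₛ n zero    _ = integral-1
  integral-1ₛ n (suc k) _ = integral-0

  integralUpTo-^ₛ : ∀ n f m → IntegralUpTo n f → IntegralUpTo n (f ^ₛ m)
  integralUpTo-^ₛ n f zero    int-f = integral-1ₛ n
  integralUpTo-^ₛ n f (suc m) int-f = integralUpTo-*ₛ n f (f ^ₛ m) int-f (integralUpTo-^ₛ n f m int-f)

  -- Long division inverts nothing but `g 0`. One step replaces `f` by a remainder that is known to
  -- be integral up to one index less, which is all the induction asks for.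
  integral-÷ₛ : ∀ n f g .{{_ : NonZero (g 0)}} → Integral (1/ (g 0)) → IntegralUpTo n f → IntegralUpTo n g →
    Integral ((f ÷ₛ g) n)
  integral-÷ₛ zero    f g int-g₀⁻¹ int-f int-g = integral-* (int-f 0 z≤n) int-g₀⁻¹
  integral-÷ₛ (suc n) f g int-g₀⁻¹ int-f int-g =
    integral-÷ₛ n (λ i → f (suc i) - (f 0 * 1/ (g 0)) * g (suc i)) g int-g₀⁻¹
    (λ k k≤n → integral-- (int-f (suc k) (s≤s k≤n))
      (integral-* (integral-* (int-f 0 z≤n) int-g₀⁻¹) (int-g (suc k) (s≤s k≤n))))
    (λ k k≤n → int-g k (ℕ.m≤n⇒m≤1+n k≤n))

  integral-exp : ∀ {t} n → Integral t → n < p → Integral (exp t n)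
  integral-exp n int-t n<p = integral-* (integral-^ n int-t) (integral-1/! n n<p)

  record Multiple (x : ℚ) : Set where
    constructor multiple
    field
      {quotient}  : ℚ
      integral-q  : Integral quotient
      ≡p*         : x ≡ fromℤ (+ p) * quotient

  multiple⇒≡mod : ∀ x y → Multiple (x - y) → x ≡ y [mod p ]
  multiple⇒≡mod x y (multiple {z} int-z eq) = z , integral⇒∈ℤₚ int-z , eq

  multiple-p : Multiple (fromℤ (+ p))
  multiple-p = multiple integral-1 (sym (*-identityʳ (fromℤ (+ p))))

  multiple-0 : Multiple 0ℚ
  multiple-0 = multiple integral-0 (sym (*-zeroʳ (fromℤ (+ p))))

  multiple-≡0 : ∀ {x} → x ≡ 0ℚ → Multiple x
  multiple-≡0 x≡0 = subst Multiple (sym x≡0) multiple-0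

  multiple-+ : ∀ {x y} → Multiple x → Multiple y → Multiple (x + y)
  multiple-+ (multiple {z} int-z refl) (multiple {w} int-w refl) =
    multiple (integral-+ int-z int-w) (sym (*-distribˡ-+ (fromℤ (+ p)) z w))

  multiple-*ˡ : ∀ {x y} → Integral x → Multiple y → Multiple (x * y)
  multiple-*ˡ {x} int-x (multiple {z} int-z refl) =
    multiple (integral-* int-x int-z) (solve 3 (λ x p z → x :* (p :* z) := p :* (x :* z))
         refl x (fromℤ (+ p)) z)

  multiple-*ʳ : ∀ {x y} → Multiple x → Integral y → Multiple (x * y)
  multiple-*ʳ {x} {y} mul-x int-y = subst Multiple (*-comm y x) (multiple-*ˡ int-y mul-x)

  multiple-neg : ∀ {x} → Multiple x → Multiple (- x)
  multiple-neg {x} mul-x =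
    subst Multiple (solve 1 (λ x → con (fromℤ -1ℤ) :* x := :- x)
         refl x) (multiple-*ˡ (integral-fromℤ -1ℤ) mul-x)

  multiple-- : ∀ {x y} → Multiple x → Multiple y → Multiple (x - y)
  multiple-- mul-x mul-y = multiple-+ mul-x (multiple-neg mul-y)

  multiple-trans : ∀ x y z → Multiple (x - y) → Multiple (y - z) → Multiple (x - z)
  multiple-trans x y z x≈y y≈z =
    subst Multiple (solve 3 (λ x y z → x :- y :+ (y :- z) := x :- z) refl x y z) (multiple-+ x≈y y≈z)

  multiple-∑ : ∀ n (h : ℕ → ℚ) → (∀ k → k ≤ n → Multiple (h k)) → Multiple (∑[ k ≤ n ] h (toℕ k))
  multiple-∑ zero    h mul-h = multiple-+ (mul-h 0 z≤n) multiple-0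
  multiple-∑ (suc n) h mul-h =
    multiple-+ (mul-h 0 z≤n) (multiple-∑ n (λ k → h (suc k)) (λ k k≤n → mul-h (suc k) (s≤s k≤n)))

  multiple-*ₛ : ∀ n f g → (∀ k → k ≤ n → Multiple (f k)) → IntegralUpTo n g → Multiple ((f *ₛ g) n)
  multiple-*ₛ n f g mul-f int-g =
    multiple-∑ n (λ k → f k * g (n ∸ k)) (λ k k≤n → multiple-*ʳ (mul-f k k≤n) (int-g (n ∸ k) (ℕ.m∸n≤m n k)))

  -- The index `suc n` lies between 1 and p - 1, so it is a unit and can be divided out of the
  -- identity given by `θ-^ₛ`.
  ^ₛ-p : ∀ f n → suc n < p → IntegralUpTo (suc n) f → Multiple ((f ^ₛ p) (suc n))
  ^ₛ-p f n 1+n<p int-f = subst Multiple lemma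
    (multiple-*ˡ (integral-1/ (suc n) (p∤n (suc n) 1+n<p))
      (multiple-*ʳ multiple-p (integral-*ₛ (suc n) (f ^ₛ ℕ.pred p) (θ f)
        (integralUpTo-^ₛ (suc n) f (ℕ.pred p) int-f)
        (λ k k≤ → integral-* (integral-fromℤ (+ k)) (int-f k k≤)))))
    where
    θ-^ₛ-p : θ (f ^ₛ p) (suc n) ≡ fromℤ (+ p) * (f ^ₛ ℕ.pred p *ₛ θ f) (suc n)
    θ-^ₛ-p =
      subst (λ m → θ (f ^ₛ m) (suc n) ≡ fromℤ (+ m) * (f ^ₛ ℕ.pred p *ₛ θ f) (suc n)) (ℕ.suc-pred p)
        (θ-^ₛ f (ℕ.pred p) (suc n))
    lemma : 1ℤ / suc n * (fromℤ (+ p) * (f ^ₛ ℕ.pred p *ₛ θ f) (suc n)) ≡ (f ^ₛ p) (suc n)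
    lemma = begin
      1ℤ / suc n * (fromℤ (+ p) * (f ^ₛ ℕ.pred p *ₛ θ f) (suc n)) ≡⟨ cong (1ℤ / suc n *_) θ-^ₛ-p ⟨
      1ℤ / suc n * (fromℤ (+ suc n) * (f ^ₛ p) (suc n))
        ≡⟨ *-assoc (1ℤ / suc n) (fromℤ (+ suc n)) ((f ^ₛ p) (suc n)) ⟨
      1ℤ / suc n * fromℤ (+ suc n) * (f ^ₛ p) (suc n)             ≡⟨ cong (_* (f ^ₛ p) (suc n)) (1/*↧ (suc n)) ⟩
      1ℚ * (f ^ₛ p) (suc n)                                       ≡⟨ *-identityˡ ((f ^ₛ p) (suc n)) ⟩
      (f ^ₛ p) (suc n)                                            ∎

  -- The constant term of f^p is exactly 1 and reproduces `g n`; all other coefficients involved are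
  -- multiples of p by `^ₛ-p`.
  ^ₛ-p-*ₛ : ∀ f g n → f 0 ≡ 1ℚ → n < p → IntegralUpTo n f → IntegralUpTo n g → Multiple ((f ^ₛ p *ₛ g) n - g n)
  ^ₛ-p-*ₛ f g zero f₀≡1 n<p int-f int-g = multiple-≡0 (begin
    (f ^ₛ p) 0 * g 0 + 0ℚ - g 0   ≡⟨ cong (λ c → c * g 0 + 0ℚ - g 0) (^ₛ-zero {f} f₀≡1 p) ⟩
    1ℚ * g 0 + 0ℚ - g 0           ≡⟨ solve 1 (λ x → con 1ℚ :* x :+ con 0ℚ :- x := con 0ℚ) refl (g 0) ⟩
    0ℚ                            ∎)
  ^ₛ-p-*ₛ f g (suc n) f₀≡1 n<p int-f int-g = subst Multiple (begin
    (tail F *ₛ g) n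
      ≡⟨ solve 2 (λ x y → y := con 1ℚ :* x :+ y :- x) refl (g (suc n)) ((tail F *ₛ g) n) ⟩
    1ℚ * g (suc n) + (tail F *ₛ g) n - g (suc n)
      ≡⟨ cong (λ c → c * g (suc n) + (tail F *ₛ g) n - g (suc n)) (^ₛ-zero {f} f₀≡1 p) ⟨
    F 0 * g (suc n) + (tail F *ₛ g) n - g (suc n)   ∎)
    (multiple-*ₛ n (tail F) g
      (λ k k≤n → ^ₛ-p f k (ℕ.≤-trans (s≤s (s≤s k≤n)) n<p) (λ i i≤ → int-f i (ℕ.≤-trans i≤ (s≤s k≤n))))
      (λ k k≤n → int-g k (ℕ.m≤n⇒m≤1+n k≤n)))
    where
    F = f ^ₛ p

  -- The product of f^p with the generating function is computed twice. Exactly, m = p - n₀ of the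
  -- factors f cancel the m inverse factors; modulo p, f^p acts as 1. The bound is on n + 1 because
  -- the n-th coefficient of f is 1/(n+1)!.
  bernoulliGF≈ : ∀ n₀ n t → n₀ ≤ p → suc n < p → Integral t →
    Multiple (bernoulliGF (p ∸ n₀) t n - ([eˣ-1]/x ^ₛ n₀ *ₛ exp t) n)
  bernoulliGF≈ n₀ n t n₀≤p 1+n<p int-t = subst Multiple (begin
    - ((f ^ₛ p *ₛ G) n - G n)              ≡⟨ cong (λ x → - (x - G n)) eq ⟩
    - ((f ^ₛ n₀ *ₛ exp t) n - G n)
      ≡⟨ solve 2 (λ a b → :- (a :- b) := b :- a) refl ((f ^ₛ n₀ *ₛ exp t) n) (G n) ⟩
    G n - (f ^ₛ n₀ *ₛ exp t) n             ∎)
    (multiple-neg (^ₛ-p-*ₛ f G n refl n<p int-f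
      (integralUpTo-*ₛ n (u ^ₛ m) (exp t) (integralUpTo-^ₛ n u m int-u)
        (λ k k≤n → integral-exp k int-t (ℕ.≤-<-trans k≤n n<p)))))
    where
    f = [eˣ-1]/x
    u = 1ₛ ÷ₛ f
    m = p ∸ n₀
    G = bernoulliGF m t
    n<p : n < p
    n<p = ℕ.<-trans (ℕ.n<1+n n) 1+n<p
    int-f : IntegralUpTo n f
    int-f k k≤n = integral-exp (suc k) integral-1 (ℕ.≤-<-trans (s≤s k≤n) 1+n<p)
    int-u : IntegralUpTo n u
    int-u k k≤n = integral-÷ₛ k 1ₛ f integral-1 (integral-1ₛ k) (λ i i≤k → int-f i (ℕ.≤-trans i≤k k≤n))
    eq : (f ^ₛ p *ₛ G) n ≡ (f ^ₛ n₀ *ₛ exp t) n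
    eq = begin
      (f ^ₛ p *ₛ G) n                                     ≡⟨ cong (λ k → (f ^ₛ k *ₛ G) n) (ℕ.m+[n∸m]≡n n₀≤p) ⟨
      (f ^ₛ (n₀ ℕ.+ m) *ₛ G) n                            ≡⟨ ^ₛ-+ f n₀ m G n ⟩
      (f ^ₛ n₀ *ₛ (f ^ₛ m *ₛ (u ^ₛ m *ₛ exp t))) n
        ≡⟨ *ₛ-congˡ (f ^ₛ n₀) (^ₛ-cancel (÷ₛ-*ₛ 1ₛ f) m (exp t)) n ⟩
      (f ^ₛ n₀ *ₛ exp t) n                                ∎

  -- Fermat's little theorem

  -- In the coefficient of x^p in eˣ eᵗˣ all terms but the first and the last are
  -- p-integral, so that p! turns them into multiples of p.
  fermat-suc : ∀ t → Integral t → Multiple ((1ℚ + t) ^ℚ p - (t ^ℚ p + 1ℚ))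
  fermat-suc t int-t = subst Multiple (sym eq)
    (multiple-*ˡ (integral-*ₛ n (tail (exp 1ℚ)) (tail (exp t)) (int 1ℚ integral-1) (int t int-t)) mul-p!)
    where
    n = p ∸ 2
    p≡2+n : p ≡ 2 ℕ.+ n
    p≡2+n = sym (ℕ.m+[n∸m]≡n 1<p)
    int : ∀ s → Integral s → IntegralUpTo n (tail (exp s))
    int s int-s k k≤n = integral-exp (suc k) int-s (ℕ.≤-trans (s≤s (s≤s k≤n)) (ℕ.≤-reflexive (sym p≡2+n)))
    X = (tail (exp 1ℚ) *ₛ tail (exp t)) n
    mul-p! : Multiple (fromℤ (+ (p !)))
    mul-p! = subst (λ m → Multiple (fromℤ (+ (m !)))) (ℕ.suc-pred p) (subst Multiple (sym (fromℕ-! (ℕ.pred p)))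
      (multiple-*ʳ (subst (λ m → Multiple (fromℤ (+ m))) (sym (ℕ.suc-pred p)) multiple-p)
        (integral-fromℤ (+ (ℕ.pred p !)))))
    eq : (1ℚ + t) ^ℚ p - (t ^ℚ p + 1ℚ) ≡ X * fromℤ (+ (p !))
    eq = begin
      (1ℚ + t) ^ℚ p - (t ^ℚ p + 1ℚ)                       ≡⟨ cong (λ x → (1ℚ + t) ^ℚ p - (t ^ℚ p + x)) (1^ℚ p) ⟨
      (1ℚ + t) ^ℚ p - (t ^ℚ p + 1ℚ ^ℚ p)
        ≡⟨ cong₂ _-_ (exp*! (1ℚ + t) p) (cong₂ _+_ (exp*! t p) (exp*! 1ℚ p)) ⟨
      exp (1ℚ + t) p * p! - (exp t p * p! + exp 1ℚ p * p!)
        ≡⟨ cong (λ x → x * p! - (exp t p * p! + exp 1ℚ p * p!)) (exp-1+-ends t n p≡2+n) ⟩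
      (exp t p + exp 1ℚ p + X) * p! - (exp t p * p! + exp 1ℚ p * p!)
        ≡⟨ solve 4 (λ a b c d → (a :+ b :+ c) :* d :- (a :* d :+ b :* d) := c :* d)
             refl (exp t p) (exp 1ℚ p) X p! ⟩
      X * p!                                              ∎
      where
      p! = fromℤ (+ (p !))

  -- In this form, as the change of a^p - a from a to a + 1, the same lemma carries Fermat's theorem
  -- from 0 upwards and downwards.
  fermat-shift : ∀ a → Multiple ((fromℤ (1ℤ ℤ.+ a) ^ℚ p - fromℤ (1ℤ ℤ.+ a)) - (fromℤ a ^ℚ p - fromℤ a))
  fermat-shift a = subst Multiple (begin
    (1ℚ + x) ^ℚ p - (x ^ℚ p + 1ℚ)
      ≡⟨ solve 3 (λ u v x → u :- (v :+ con 1ℚ) := u :- (con 1ℚ :+ x) :- (v :- x))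
           refl ((1ℚ + x) ^ℚ p) (x ^ℚ p) x ⟩
    (1ℚ + x) ^ℚ p - (1ℚ + x) - (x ^ℚ p - x)
      ≡⟨ cong (λ y → y ^ℚ p - y - (x ^ℚ p - x)) (fromℤ-+ 1ℤ a) ⟨
    fromℤ (1ℤ ℤ.+ a) ^ℚ p - fromℤ (1ℤ ℤ.+ a) - (x ^ℚ p - x)    ∎)
    (fermat-suc x (integral-fromℤ a))
    where
    x = fromℤ a

  fermat : ∀ a → Multiple (fromℤ a ^ℚ p - fromℤ a)
  fermat (+ zero) =
    subst (λ m → Multiple (0ℚ ^ℚ m - 0ℚ)) (ℕ.suc-pred p)
      (multiple-≡0 (trans (+-identityʳ (0ℚ * 0ℚ ^ℚ ℕ.pred p)) (*-zeroˡ (0ℚ ^ℚ ℕ.pred p))))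
  fermat ℤ.+[1+ n ] = subst Multiple
    (solve 2 (λ x y → x :- y :+ y := x)
         refl (fromℤ (+ suc n) ^ℚ p - fromℤ (+ suc n)) (fromℤ (+ n) ^ℚ p - fromℤ (+ n)))
    (multiple-+ (fermat-shift (+ n)) (fermat (+ n)))
  fermat (ℤ.-[1+ n ]) = subst Multiple
    (solve 2 (λ x y → y :- (y :- x) := x)
         refl (fromℤ (ℤ.-[1+ n ]) ^ℚ p - fromℤ (ℤ.-[1+ n ]))
           (fromℤ (1ℤ ℤ.+ ℤ.-[1+ n ]) ^ℚ p - fromℤ (1ℤ ℤ.+ ℤ.-[1+ n ])))
    (multiple-- (previous n) (fermat-shift (ℤ.-[1+ n ])))
    where
    previous : ∀ n → Multiple (fromℤ (1ℤ ℤ.+ ℤ.-[1+ n ]) ^ℚ p - fromℤ (1ℤ ℤ.+ ℤ.-[1+ n ]))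
    previous zero    = fermat (+ 0)
    previous (suc n) = fermat (ℤ.-[1+ n ])

  unit-inverse : ∀ a → ¬ p ∣ ℤ.∣ a ∣ → ∃[ v ] (Integral v × fromℤ a * v ≡ 1ℚ)
  unit-inverse (+ zero)     p∤0 = contradiction (p ∣0) p∤0
  unit-inverse ℤ.+[1+ n ]   p∤a =
    1ℤ / suc n , integral-1/ (suc n) p∤a , trans (*-comm (fromℤ (+ suc n)) (1ℤ / suc n)) (1/*↧ (suc n))
  unit-inverse (ℤ.-[1+ n ]) p∤a = - (1ℤ / suc n) , integral-neg (integral-1/ (suc n) p∤a) ,
    trans (solve 2 (λ x v → (:- x) :* (:- v) := v :* x) refl (fromℤ (+ suc n)) (1ℤ / suc n)) (1/*↧ (suc n))

  ^ℚ-p : ∀ x → x ^ℚ p ≡ x * x ^ℚ (p ∸ 1)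
  ^ℚ-p x = cong (x ^ℚ_) (sym (ℕ.suc-pred p))

  fermat′ : ∀ a → ¬ p ∣ ℤ.∣ a ∣ → Multiple (fromℤ a ^ℚ (p ∸ 1) - 1ℚ)
  fermat′ a p∤a with unit-inverse a p∤a
  ... | v , int-v , av≡1 = subst Multiple (begin
    (x ^ℚ p - x) * v                   ≡⟨ cong (λ y → (y - x) * v) (^ℚ-p x) ⟩
    (x * y - x) * v
      ≡⟨ solve 3 (λ x y v → (x :* y :- x) :* v := (x :* v) :* (y :- con 1ℚ)) refl x y v ⟩
    x * v * (y - 1ℚ)                   ≡⟨ cong (_* (y - 1ℚ)) av≡1 ⟩
    1ℚ * (y - 1ℚ)                      ≡⟨ *-identityˡ (y - 1ℚ) ⟩
    y - 1ℚ                             ∎) (multiple-*ʳ (fermat a) int-v)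
    where
    x = fromℤ a
    y = x ^ℚ (p ∸ 1)

  q*p : ∀ a → q p a * fromℤ (+ p) ≡ fromℤ a ^ℚ (p ∸ 1) - 1ℚ
  q*p a =
    trans (/*↧ (a ^ (p ∸ 1) ℤ.- 1ℤ) p) (trans (fromℤ-- (a ^ (p ∸ 1)) 1ℤ) (cong (_- 1ℚ) (fromℤ-^ a (p ∸ 1))))

  -- The product is (a^p - a)/p, so Fermat applies also when p divides a, where `q p a` itself is
  -- not integral.
  integral-*q : ∀ a → Integral (fromℤ a * q p a)
  integral-*q a with fermat a
  ... | multiple {z} int-z eq = subst Integral (*-cancelʳ-fromℕ p (begin
    z * fromℤ (+ p)                         ≡⟨ *-comm z (fromℤ (+ p)) ⟩
    fromℤ (+ p) * z                         ≡⟨ eq ⟨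
    x ^ℚ p - x                              ≡⟨ cong (_- x) (^ℚ-p x) ⟩
    x * x ^ℚ (p ∸ 1) - x
      ≡⟨ solve 2 (λ x y → x :* y :- x := x :* (y :- con 1ℚ)) refl x (x ^ℚ (p ∸ 1)) ⟩
    x * (x ^ℚ (p ∸ 1) - 1ℚ)                 ≡⟨ cong (x *_) (q*p a) ⟨
    x * (q p a * fromℤ (+ p))               ≡⟨ *-assoc x (q p a) (fromℤ (+ p)) ⟨
    x * q p a * fromℤ (+ p)                 ∎)) int-z
    where
    x = fromℤ a

  -- Factorials modulo p

  integral-sgn : ∀ n → Integral (sgn n)
  integral-sgn n = integral-fromℤ (-1ℤ ^ n)

  integral-fac : ∀ n → Integral (fac n)
  integral-fac n = integral-fromℤ (+ (n !))

  -- Since p = (a+1) + (b+1), the factor b + 1 of (b+1)! is congruent to -(a+1). Each such exchange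
  -- moves a factor over to a! and flips the sign, beginning with the trivial case a = 0.
  factorial-reflection : ∀ a b → suc (a ℕ.+ b) ≡ p → Multiple (fac (p ∸ 1) - sgn a * (fac a * fac b))
  factorial-reflection zero    b eq = multiple-≡0 (trans (cong (λ m → fac (m ∸ 1) - 1ℚ * (1ℚ * fac b)) (sym eq))
    (solve 1 (λ x → x :- con 1ℚ :* (con 1ℚ :* x) := con 0ℚ) refl (fac b)))
  factorial-reflection (suc a) b eq = subst Multiple (begin
    F - sgn a * (fac a * fac (suc b)) + sgn a * (fac a * fac b) * fromℤ (+ p)
      ≡⟨ cong₂ (λ x y → F - sgn a * (fac a * x) + sgn a * (fac a * fac b) * y) (fromℕ-! b) p≡ ⟩
    F - sgn a * (fac a * (β * fac b)) + sgn a * (fac a * fac b) * (α + β)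
      ≡⟨ solve 6 (λ F s a b α β → F :- s :* (a :* (β :* b)) :+ s :* (a :* b) :* (α :+ β)
             := F :- (:- s) :* (α :* a :* b))
           refl F (sgn a) (fac a) (fac b) α β ⟩
    F - (- sgn a) * (α * fac a * fac b)
      ≡⟨ cong₂ (λ x y → F - x * (y * fac b)) (sgn-suc a) (fromℕ-! a) ⟨
    F - sgn (suc a) * (fac (suc a) * fac b) ∎)
    (multiple-+ (factorial-reflection a (suc b) (trans (cong suc (ℕ.+-suc a b)) eq))
      (multiple-*ˡ (integral-* (integral-sgn a) (integral-* (integral-fac a) (integral-fac b))) multiple-p))
    where
    F = fac (p ∸ 1)
    α = fromℤ (+ suc a)
    β = fromℤ (+ suc b)
    p≡ : fromℤ (+ p) ≡ α + β
    p≡ =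
      trans (cong (λ m → fromℤ (+ m)) (trans (sym eq) (cong suc (sym (ℕ.+-suc a b))))) (fromℕ-+ (suc a) (suc b))

  -- The product (p-1)! (p+1) ... (p+b), which is (p+b)! with its factor p left out. For b < p it is
  -- prime to p.
  [p+_]!/p : ℕ → ℕ
  [p+ zero ]!/p  = (p ∸ 1) !
  [p+ suc b ]!/p = (p ℕ.+ suc b) ℕ.* [p+ b ]!/p

  [p+b]!≡p*[p+b]!/p : ∀ b → (p ℕ.+ b) ! ≡ p ℕ.* [p+ b ]!/p
  [p+b]!≡p*[p+b]!/p zero = begin
    (p ℕ.+ 0) !                     ≡⟨ cong _! (ℕ.+-identityʳ p) ⟩
    p !                             ≡⟨ cong _! (ℕ.suc-pred p) ⟨
    suc (p ∸ 1) ℕ.* (p ∸ 1) !       ≡⟨ cong (ℕ._* (p ∸ 1) !) (ℕ.suc-pred p) ⟩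
    p ℕ.* (p ∸ 1) !                 ∎
  [p+b]!≡p*[p+b]!/p (suc b) = begin
    (p ℕ.+ suc b) !                       ≡⟨ cong _! (ℕ.+-suc p b) ⟩
    suc (p ℕ.+ b) ℕ.* (p ℕ.+ b) !         ≡⟨ cong₂ ℕ._*_ (sym (ℕ.+-suc p b)) ([p+b]!≡p*[p+b]!/p b) ⟩
    (p ℕ.+ suc b) ℕ.* (p ℕ.* [p+ b ]!/p)
      ≡⟨ ℕS.solve 3 (λ x y z → x ℕS.:* (y ℕS.:* z) ℕS.:= y ℕS.:* (x ℕS.:* z)) refl (p ℕ.+ suc b) p [p+ b ]!/p ⟩
    p ℕ.* [p+ suc b ]!/p                  ∎

  p∤[p+b]!/p : ∀ b → b < p → ¬ p ∣ [p+ b ]!/p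
  p∤[p+b]!/p zero    _   = p∤! (p ∸ 1) (ℕ.≤-reflexive (ℕ.suc-pred p))
  p∤[p+b]!/p (suc b) b<p = p∤* (p ℕ.+ suc b) [p+ b ]!/p
    (λ p∣ → p∤n (suc b) b<p (∣m+n∣m⇒∣n p∣ ∣-refl))
    (p∤[p+b]!/p b (ℕ.<-trans (ℕ.n<1+n b) b<p))

  -- Modulo p each factor p + i becomes i.
  [p+b]!/p≈ : ∀ b → Multiple (fromℤ (+ [p+ b ]!/p) - fac (p ∸ 1) * fac b)
  [p+b]!/p≈ zero    = multiple-≡0 (solve 1 (λ x → x :- x :* con 1ℚ := con 0ℚ) refl (fac (p ∸ 1)))
  [p+b]!/p≈ (suc b) = subst Multiple (begin
    π * M + β * (M - F * fac b)
      ≡⟨ solve 5 (λ p M β F b → p :* M :+ β :* (M :- F :* b) := (p :+ β) :* M :- F :* (β :* b))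
           refl π M β F (fac b) ⟩
    (π + β) * M - F * (β * fac b)
      ≡⟨ cong₂ (λ x y → x * M - F * y) (sym (fromℕ-+ p (suc b))) (sym (fromℕ-! b)) ⟩
    fromℤ (+ (p ℕ.+ suc b)) * M - F * fac (suc b)
      ≡⟨ cong (_- F * fac (suc b)) (fromℕ-* (p ℕ.+ suc b) [p+ b ]!/p) ⟨
    fromℤ (+ [p+ suc b ]!/p) - F * fac (suc b)     ∎)
    (multiple-+ (multiple-*ʳ multiple-p (integral-fromℤ (+ [p+ b ]!/p)))
      (multiple-*ˡ (integral-fromℤ (+ suc b)) ([p+b]!/p≈ b)))
    where
    π = fromℤ (+ p)
    M = fromℤ (+ [p+ b ]!/p)
    β = fromℤ (+ suc b)
    F = fac (p ∸ 1)

  -- Certifies that p/(p+b)! is p-integral for b < p: `[p+ b ]!/p` serves as its denominator in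
  -- `factorial-quotient`.
  p/[p+b]! : ∀ b → 1/! (p ℕ.+ b) * fromℤ (+ p) * fromℤ (+ [p+ b ]!/p) ≡ 1ℚ
  p/[p+b]! b = begin
    1/! (p ℕ.+ b) * fromℤ (+ p) * fromℤ (+ [p+ b ]!/p)
      ≡⟨ *-assoc (1/! (p ℕ.+ b)) (fromℤ (+ p)) (fromℤ (+ [p+ b ]!/p)) ⟩
    1/! (p ℕ.+ b) * (fromℤ (+ p) * fromℤ (+ [p+ b ]!/p))   ≡⟨ cong (1/! (p ℕ.+ b) *_) (fromℕ-* p [p+ b ]!/p) ⟨
    1/! (p ℕ.+ b) * fromℤ (+ (p ℕ.* [p+ b ]!/p))
      ≡⟨ cong (λ m → 1/! (p ℕ.+ b) * fromℤ (+ m)) ([p+b]!≡p*[p+b]!/p b) ⟨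
    1/! (p ℕ.+ b) * fac (p ℕ.+ b)                          ≡⟨ 1/!*! (p ℕ.+ b) ⟩
    1ℚ                                                     ∎

  -- The denominator (p+b)!/p is congruent to (p-1)! b!, and reflection turns this into (-1)^a a! n!
  -- b!. The factor n! then cancels.
  factorial-quotient : ∀ a b n → suc (a ℕ.+ n) ≡ p → b < p →
    Multiple (fac n * (1/! (p ℕ.+ b) * fromℤ (+ p)) - sgn a * (1ℤ / (a ! ℕ.* b !)) {{a !* b !≢0}})
  factorial-quotient a b n eq b<p = subst Multiple (begin
    -- The difference of the two denominators times their inverses: w M = 1, i a! b! = 1, and the
    -- sign squares to 1.
    - (w * i * sgn a) * (M - sgn a * (fac a * fac n) * fac b)
      ≡⟨ solve 7 (λ w i s M a n b → :- (w :* i :* s) :* (M :- s :* (a :* n) :* b)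
             := s :* s :* (i :* (a :* b)) :* (n :* w) :- s :* i :* (w :* M))
           refl w i (sgn a) M (fac a) (fac n) (fac b) ⟩
    sgn a * sgn a * (i * (fac a * fac b)) * (fac n * w) - sgn a * i * (w * M)
      ≡⟨ cong₂ (λ x y → x * y * (fac n * w) - sgn a * i * (w * M)) (sgn*sgn a) i-inverse ⟩
    1ℚ * 1ℚ * (fac n * w) - sgn a * i * (w * M)
      ≡⟨ cong (λ x → 1ℚ * 1ℚ * (fac n * w) - sgn a * i * x) (p/[p+b]! b) ⟩
    1ℚ * 1ℚ * (fac n * w) - sgn a * i * 1ℚ
      ≡⟨ solve 2 (λ x y → con 1ℚ :* con 1ℚ :* x :- y :* con 1ℚ := x :- y) refl (fac n * w) (sgn a * i) ⟩
    fac n * w - sgn a * i ∎)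
    (multiple-*ˡ (integral-neg (integral-* (integral-* int-w int-i) (integral-sgn a)))
      (multiple-trans M (fac (p ∸ 1) * fac b) (sgn a * (fac a * fac n) * fac b) ([p+b]!/p≈ b)
        (subst Multiple (solve 3 (λ x y z → (x :- y) :* z := x :* z :- y :* z)
             refl (fac (p ∸ 1)) (sgn a * (fac a * fac n)) (fac b))
          (multiple-*ʳ (factorial-reflection a n eq) (integral-fac b)))))
    where
    w = 1/! (p ℕ.+ b) * fromℤ (+ p)
    i = (1ℤ / (a ! ℕ.* b !)) {{a !* b !≢0}}
    M = fromℤ (+ [p+ b ]!/p)
    int-w : Integral w
    int-w = integral {num = 1ℤ} (p∤[p+b]!/p b b<p) (p/[p+b]! b)
    a<p : a < p
    a<p = ℕ.≤-trans (s≤s (ℕ.m≤m+n a n)) (ℕ.≤-reflexive eq)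
    int-i : Integral i
    int-i = integral-1/ (a ! ℕ.* b !) {{a !* b !≢0}} (p∤* (a !) (b !) (p∤! a a<p) (p∤! b b<p))
    i-inverse : i * (fac a * fac b) ≡ 1ℚ
    i-inverse = trans (cong (i *_) (sym (fromℕ-* (a !) (b !)))) (1/*↧ (a ! ℕ.* b !) {{a !* b !≢0}})

  -- The index ρ will be {r}_p, which may exceed the upper limit n₀; the last hypothesis makes the
  -- absent term negligible in that case.
  multiple-∑-single : ∀ n ρ (h : ℕ → ℚ) → (∀ k → k ≤ n → k ≢ ρ → Multiple (h k)) → (n < ρ → Multiple (h ρ)) →
    Multiple (∑[ k ≤ n ] h (toℕ k) - h ρ)
  multiple-∑-single zero zero h _ _ = multiple-≡0 (solve 1 (λ x → x :+ con 0ℚ :- x := con 0ℚ) refl (h 0))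
  multiple-∑-single zero (suc ρ) h mul-h mul-hρ =
    multiple-- (multiple-+ (mul-h 0 z≤n (λ ())) multiple-0) (mul-hρ (s≤s z≤n))
  multiple-∑-single (suc n) zero h mul-h _ =
    subst Multiple (solve 2 (λ x y → y := x :+ y :- x) refl (h 0) (∑[ k ≤ n ] h (suc (toℕ k))))
    (multiple-∑ n (λ k → h (suc k)) (λ k k≤n → mul-h (suc k) (s≤s k≤n) (λ ())))
  multiple-∑-single (suc n) (suc ρ) h mul-h mul-hρ =
    subst Multiple (sym (+-assoc (h 0) (∑[ k ≤ n ] h (suc (toℕ k))) (- h (suc ρ))))
    (multiple-+ (mul-h 0 z≤n (λ ())) (multiple-∑-single n ρ (λ k → h (suc k))
      (λ k k≤n k≢ρ → mul-h (suc k) (s≤s k≤n) (λ where refl → k≢ρ refl)) (λ n<ρ → mul-hρ (s≤s n<ρ))))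

  -- Combines `bernoulliGF≈`, multiplied by n!, with `Δ-powers`. The factor 1/N! stays inside
  -- because it need not be integral by itself.
  B≈ : ∀ n₀ n t {N} → n₀ ≤ p → suc n < p → n ℕ.+ n₀ ≡ N →
    Multiple (B (p ∸ n₀) n (fromℤ t) - fac n * (Δ n₀ (powers t N) * 1/! N))
  B≈ n₀ n t {N} n₀≤p 1+n<p n+n₀≡N = subst Multiple (begin
    fac n * (G - ([eˣ-1]/x ^ₛ n₀ *ₛ exp (fromℤ t)) n)
      ≡⟨ cong (λ x → fac n * (G - x)) (Δ-powers n₀ t n n+n₀≡N) ⟨
    fac n * (G - Δ n₀ (powers t N) * 1/! N)
      ≡⟨ solve 3 (λ f x y → f :* (x :- y) := f :* x :- f :* y) refl (fac n) G (Δ n₀ (powers t N) * 1/! N) ⟩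
    fac n * G - fac n * (Δ n₀ (powers t N) * 1/! N)     ∎)
    (multiple-*ˡ (integral-fac n) (bernoulliGF≈ n₀ n (fromℤ t) n₀≤p 1+n<p (integral-fromℤ t)))
    where
    G = bernoulliGF (p ∸ n₀) (fromℤ t) n

  -- Divisibility of k - r by p

  residue-split : ∀ r k → + k ℤ.- r ≡ (k ℤ.⊖ (r %ℕ p)) ℤ.- (r /ℕ p) ℤ.* + p
  residue-split r k = begin
    + k ℤ.- r                                          ≡⟨ cong (λ s → + k ℤ.- s) (a≡a%ℕn+[a/ℕn]*n r p) ⟩
    + k ℤ.- (+ ρ ℤ.+ s)
      ≡⟨ ℤS.solve 3 (λ k ρ s → k ℤS.:- (ρ ℤS.:+ s) ℤS.:= (k ℤS.:- ρ) ℤS.:- s) refl (+ k) (+ ρ) s ⟩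
    (+ k ℤ.- + ρ) ℤ.- s                                ≡⟨ cong (ℤ._- s) (ℤ.m-n≡m⊖n k ρ) ⟩
    (k ℤ.⊖ ρ) ℤ.- s                                    ∎
    where
    ρ = r %ℕ p
    s = (r /ℕ p) ℤ.* + p

  -- With ρ = {r}_p, k - r differs from k - ρ by a multiple of p, and 0 < |k - ρ| < p.
  p∤k-r : ∀ r k → k < p → k ≢ r %ℕ p → ¬ p ∣ ℤ.∣ + k ℤ.- r ∣
  p∤k-r r k k<p k≢ρ p∣k-r =
    p∤n ℤ.∣ k ℤ.⊖ ρ ∣ {{ℕ.≢-nonZero (k≢ρ ∘ ∣m⊖n∣≡0⇒m≡n)}} (∣m⊖n∣<p k<p (n%ℕd<d r p)) (ℤ.∣⇒∣ᵤ p∣k⊖ρ)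
    where
    ρ = r %ℕ p
    p∣k⊖ρ : + p ℤ.∣ (k ℤ.⊖ ρ)
    p∣k⊖ρ = subst (+ p ℤ.∣_)
      (trans (cong (ℤ._+ (r /ℕ p) ℤ.* + p) (residue-split r k))
        (ℤS.solve 2 (λ x y → x ℤS.:- y ℤS.:+ y ℤS.:= x) refl (k ℤ.⊖ ρ) ((r /ℕ p) ℤ.* + p)))
      (ℤ.∣m∣n⇒∣m+n (ℤ.∣ᵤ⇒∣ {+ p} {+ k ℤ.- r} p∣k-r) (ℤ.∣n⇒∣m*n (r /ℕ p) ℤ.∣-refl))

  multiple-residue : ∀ r → Multiple (fromℤ (+ (r %ℕ p) ℤ.- r))
  multiple-residue r = subst Multiple (begin
    - (fromℤ (r /ℕ p) * fromℤ (+ p))        ≡⟨ cong -_ (fromℤ-* (r /ℕ p) (+ p)) ⟨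
    - fromℤ s                               ≡⟨ fromℤ-neg s ⟨
    fromℤ (ℤ.- s)                           ≡⟨ cong fromℤ (ℤ.+-identityˡ (ℤ.- s)) ⟨
    fromℤ (+ 0 ℤ.- s)                       ≡⟨ cong (λ z → fromℤ (z ℤ.- s)) (ℤ.n⊖n≡0 (r %ℕ p)) ⟨
    fromℤ ((r %ℕ p) ℤ.⊖ (r %ℕ p) ℤ.- s)     ≡⟨ cong fromℤ (residue-split r (r %ℕ p)) ⟨
    fromℤ (+ (r %ℕ p) ℤ.- r)                ∎)
    (multiple-neg (multiple-*ˡ (integral-fromℤ (r /ℕ p)) multiple-p))
    where
    s = (r /ℕ p) ℤ.* + p

  -- Subtracting the exponent 0 leaves the factor (k-r)^(p-1) - 1 in each term. It is a multiple of
  -- p for k ≠ ρ by Fermat and congruent to -1 for k = ρ, as p divides ρ - r. If ρ > n₀, the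
  -- binomial coefficient is 0.
  Δ-powers-p-1 : ∀ r n₀ → 0 < n₀ → n₀ < p →
    Multiple (Δ n₀ (powers (ℤ.- r) (p ∸ 1)) - - (sgn n₀ * (fromℤ (+ (n₀ C (r %ℕ p))) * sgn (r %ℕ p))))
  Δ-powers-p-1 r n₀ 0<n₀ n₀<p = subst Multiple (begin
    -- The added multiple of p cancels the power inside `h ρ`, so that only its constant part
    -- remains.
    ∑[ k ≤ n₀ ] h (toℕ k) - h ρ + fromℤ (signedC n₀ ρ) * a ρ ^ℚ (p ∸ 1)
      ≡⟨ cong (λ x → ∑[ k ≤ n₀ ] h (toℕ k) - x + fromℤ (signedC n₀ ρ) * a ρ ^ℚ (p ∸ 1)) (h≡ ρ) ⟩
    ∑[ k ≤ n₀ ] h (toℕ k) - fromℤ (signedC n₀ ρ) * (a ρ ^ℚ (p ∸ 1) - 1ℚ) + fromℤ (signedC n₀ ρ) * a ρ ^ℚ (p ∸ 1)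
      ≡⟨ solve 3 (λ S c x → S :- c :* (x :- con 1ℚ) :+ c :* x := S :- (:- c))
           refl (∑[ k ≤ n₀ ] h (toℕ k)) (fromℤ (signedC n₀ ρ)) (a ρ ^ℚ (p ∸ 1)) ⟩
    ∑[ k ≤ n₀ ] h (toℕ k) - - fromℤ (signedC n₀ ρ)
      ≡⟨ cong₂ (λ x y → x - - y) (sym (Δ-difference n₀ (ℤ.- r) (p ∸ 1) 0<n₀)) c≡ ⟩
    Δ n₀ (powers (ℤ.- r) (p ∸ 1)) - - (sgn n₀ * (fromℤ (+ (n₀ C ρ)) * sgn ρ)) ∎)
    (multiple-+
      (multiple-∑-single n₀ ρ h
        (λ k k≤n₀ k≢ρ → subst Multiple (sym (h≡ k)) (multiple-*ˡ (integral-fromℤ (signedC n₀ k))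
          (fermat′ (+ k ℤ.- r) (p∤k-r r k (ℕ.≤-<-trans k≤n₀ n₀<p) k≢ρ))))
        (λ n₀<ρ → multiple-≡0 (trans (h≡ ρ) (trans
          (cong (λ c → fromℤ (+ c ℤ.* -1ℤ ^ (n₀ ∸ ρ)) * (a ρ ^ℚ (p ∸ 1) - 1ℚ)) (k>n⇒nCk≡0 n₀<ρ))
            (*-zeroˡ (a ρ ^ℚ (p ∸ 1) - 1ℚ))))))
      (multiple-*ˡ (integral-fromℤ (signedC n₀ ρ)) (multiple-power (p ∸ 1) (ℕ.m<n⇒0<n∸m 1<p))))
    where
    ρ = r %ℕ p
    a h : ℕ → ℚ
    a k = fromℤ (+ k ℤ.- r)
    h k = fromℤ (signedC n₀ k ℤ.* powers (ℤ.- r) (p ∸ 1) k) - fromℤ (signedC n₀ k ℤ.* powers (ℤ.- r) 0 k)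
    h≡ : ∀ k → h k ≡ fromℤ (signedC n₀ k) * (a k ^ℚ (p ∸ 1) - 1ℚ)
    h≡ k = begin
      h k
        ≡⟨ cong₂ _-_ (fromℤ-* (signedC n₀ k) ((+ k ℤ.- r) ^ (p ∸ 1))) (fromℤ-* (signedC n₀ k) 1ℤ) ⟩
      c * fromℤ ((+ k ℤ.- r) ^ (p ∸ 1)) - c * 1ℚ  ≡⟨ cong (λ x → c * x - c * 1ℚ) (fromℤ-^ (+ k ℤ.- r) (p ∸ 1)) ⟩
      c * a k ^ℚ (p ∸ 1) - c * 1ℚ
        ≡⟨ solve 2 (λ c x → c :* x :- c :* con 1ℚ := c :* (x :- con 1ℚ)) refl c (a k ^ℚ (p ∸ 1)) ⟩
      c * (a k ^ℚ (p ∸ 1) - 1ℚ)                   ∎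
      where
      c = fromℤ (signedC n₀ k)
    c≡ : fromℤ (signedC n₀ ρ) ≡ sgn n₀ * (fromℤ (+ (n₀ C ρ)) * sgn ρ)
    c≡ =
      trans (cong fromℤ (signedC-sgn n₀ ρ)) (trans (fromℤ-* (-1ℤ ^ n₀) (+ (n₀ C ρ) ℤ.* -1ℤ ^ ρ))
        (cong (sgn n₀ *_) (fromℤ-* (+ (n₀ C ρ)) (-1ℤ ^ ρ))))
    multiple-power : ∀ m → 0 < m → Multiple (a ρ ^ℚ m)
    multiple-power (suc m) _ = multiple-*ʳ (multiple-residue r) (integral-^ m (integral-fromℤ (+ ρ ℤ.- r)))

  -- With A = k - r, A^(p+b) - A^(b+1) = A^(b+1) (A^(p-1) - 1), and the last factor is p times the
  -- Fermat quotient. Equality, not congruence, is what survives the later division by (p+b)!.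
  Δ-powers-p+ : ∀ r n₀ b → suc b < n₀ →
    Δ n₀ (powers (ℤ.- r) (p ℕ.+ b)) ≡ sgn n₀ * fromℤ (+ p) *
      ∑[ k ≤ n₀ ] (fromℤ (+ (n₀ C toℕ k) ℤ.* -1ℤ ^ toℕ k ℤ.* (+ toℕ k ℤ.- r) ^ suc b) * q p (+ toℕ k ℤ.- r))
  Δ-powers-p+ r n₀ b 1+b<n₀ = trans (Δ-difference n₀ (ℤ.- r) (p ℕ.+ b) 1+b<n₀)
    (trans (sum-cong-≗ {suc n₀} (λ k → term (toℕ k))) (∑-*ˡ (sgn n₀ * fromℤ (+ p)) n₀ y))
    where
    y : ℕ → ℚ
    y k = fromℤ (+ (n₀ C k) ℤ.* -1ℤ ^ k ℤ.* (+ k ℤ.- r) ^ suc b) * q p (+ k ℤ.- r)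
    term : ∀ k →
      fromℤ (signedC n₀ k ℤ.* powers (ℤ.- r) (p ℕ.+ b) k) - fromℤ
        (signedC n₀ k ℤ.* powers (ℤ.- r) (suc b) k) ≡ sgn n₀ * fromℤ (+ p) * y k
    term k = begin
      fromℤ (signedC n₀ k ℤ.* A ^ (p ℕ.+ b)) - fromℤ (signedC n₀ k ℤ.* A ^ suc b)
        ≡⟨ cong₂ _-_ (push (p ℕ.+ b)) (push (suc b)) ⟩
      s * c * fromℤ (A ^ (p ℕ.+ b)) - s * c * fromℤ (A ^ suc b)
        ≡⟨ cong (λ m → s * c * fromℤ (A ^ m) - s * c * fromℤ (A ^ suc b)) p+b≡ ⟩
      s * c * fromℤ (A ^ (suc b ℕ.+ (p ∸ 1))) - s * c * fromℤ (A ^ suc b)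
        ≡⟨ cong (λ x → s * c * x - s * c * fromℤ (A ^ suc b))
          (trans (cong fromℤ (ℤ.^-distribˡ-+-* A (suc b) (p ∸ 1)))
            (trans (fromℤ-* (A ^ suc b) (A ^ (p ∸ 1))) (cong (fromℤ (A ^ suc b) *_) (fromℤ-^ A (p ∸ 1))))) ⟩
      s * c * (fromℤ (A ^ suc b) * fromℤ A ^ℚ (p ∸ 1)) - s * c * fromℤ (A ^ suc b)
        ≡⟨ solve 4 (λ s c u v → s :* c :* (u :* v) :- s :* c :* u := s :* c :* u :* (v :- con 1ℚ))
             refl s c (fromℤ (A ^ suc b)) (fromℤ A ^ℚ (p ∸ 1)) ⟩
      s * c * fromℤ (A ^ suc b) * (fromℤ A ^ℚ (p ∸ 1) - 1ℚ)
        ≡⟨ cong (s * c * fromℤ (A ^ suc b) *_) (q*p A) ⟨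
      s * c * fromℤ (A ^ suc b) * (q p A * fromℤ (+ p))
        ≡⟨ solve 5 (λ s c u q p → s :* c :* u :* (q :* p) := s :* p :* (c :* u :* q))
             refl s c (fromℤ (A ^ suc b)) (q p A) (fromℤ (+ p)) ⟩
      s * fromℤ (+ p) * (c * fromℤ (A ^ suc b) * q p A)
        ≡⟨ cong (λ x → s * fromℤ (+ p) * (x * q p A)) (fromℤ-* (+ (n₀ C k) ℤ.* -1ℤ ^ k) (A ^ suc b)) ⟨
      s * fromℤ (+ p) * y k ∎
      where
      A = + k ℤ.- r
      s = sgn n₀
      c = fromℤ (+ (n₀ C k) ℤ.* -1ℤ ^ k)
      push : ∀ m → fromℤ (signedC n₀ k ℤ.* A ^ m) ≡ s * c * fromℤ (A ^ m)
      push m =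
        trans (fromℤ-* (signedC n₀ k) (A ^ m))
          (cong (_* fromℤ (A ^ m)) (trans (cong fromℤ (signedC-sgn n₀ k))
            (fromℤ-* (-1ℤ ^ n₀) (+ (n₀ C k) ℤ.* -1ℤ ^ k))))
      p+b≡ : p ℕ.+ b ≡ suc b ℕ.+ (p ∸ 1)
      p+b≡ = trans (cong (ℕ._+ b) (sym (ℕ.suc-pred p))) (cong suc (ℕ.+-comm (p ∸ 1) b))

  -- One of the b + 1 factors k - r is spent on making the Fermat quotient integral.
  integral-∑-*q : ∀ (c : ℕ → ℤ) r n b →
    Integral (∑[ k ≤ n ] (fromℤ (c (toℕ k) ℤ.* (+ toℕ k ℤ.- r) ^ suc b) * q p (+ toℕ k ℤ.- r)))
  integral-∑-*q c r n b =
    integral-∑ n (λ k → fromℤ (c k ℤ.* (+ k ℤ.- r) ^ suc b) * q p (+ k ℤ.- r)) (λ k _ → term k)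
    where
    term : ∀ k → Integral (fromℤ (c k ℤ.* (+ k ℤ.- r) ^ suc b) * q p (+ k ℤ.- r))
    term k = subst Integral (begin
      fromℤ (c k) * fromℤ (A ^ b) * (fromℤ A * q p A)
        ≡⟨ solve 4 (λ c u a q → c :* u :* (a :* q) := c :* (a :* u) :* q)
             refl (fromℤ (c k)) (fromℤ (A ^ b)) (fromℤ A) (q p A) ⟩
      fromℤ (c k) * (fromℤ A * fromℤ (A ^ b)) * q p A
        ≡⟨ cong (λ x → fromℤ (c k) * x * q p A) (fromℤ-* A (A ^ b)) ⟨
      fromℤ (c k) * fromℤ (A ^ suc b) * q p A            ≡⟨ cong (_* q p A) (fromℤ-* (c k) (A ^ suc b)) ⟨
      fromℤ (c k ℤ.* A ^ suc b) * q p A                  ∎)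
      (integral-* (integral-* (integral-fromℤ (c k)) (integral-fromℤ (A ^ b))) (integral-*q A))
      where
      A = + k ℤ.- r

  -- The three congruences

  B-≤ : ∀ r n₀ n₁ → suc n₁ < p → (n₀≤n₁ : n₀ ≤ n₁) →
    B (p ∸ n₀) (n₁ ∸ n₀) (fromℤ (ℤ.- r)) ≡ (1ℤ / (n₁ P n₀)) {{nPk≢0 n₀≤n₁}} * Δ n₀ (powers (ℤ.- r) n₁) [mod p ]
  B-≤ r n₀ n₁ 1+n₁<p n₀≤n₁ = multiple⇒≡mod X ((1ℤ / (n₁ P n₀)) {{nPk≢0 n₀≤n₁}} * D)
    (subst (λ x → Multiple (X - x)) (begin
    fac (n₁ ∸ n₀) * (D * 1/! n₁)
      ≡⟨ solve 3 (λ f d i → f :* (d :* i) := f :* i :* d) refl (fac (n₁ ∸ n₀)) D (1/! n₁) ⟩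
    fac (n₁ ∸ n₀) * 1/! n₁ * D                 ≡⟨ cong (_* D) ([n∸k]!/n!≡1/nPk n₀≤n₁) ⟩
    (1ℤ / (n₁ P n₀)) {{nPk≢0 n₀≤n₁}} * D       ∎)
    (B≈ n₀ (n₁ ∸ n₀) (ℤ.- r) (ℕ.≤-trans n₀≤n₁ (ℕ.<⇒≤ (ℕ.<-trans (ℕ.n<1+n n₁) 1+n₁<p)))
      (ℕ.≤-<-trans (s≤s (ℕ.m∸n≤m n₁ n₀)) 1+n₁<p) (ℕ.m∸n+n≡m n₀≤n₁)))
    where
    X = B (p ∸ n₀) (n₁ ∸ n₀) (fromℤ (ℤ.- r))
    D = Δ n₀ (powers (ℤ.- r) n₁)

  B-zero : ∀ r n₀ n → suc (n₀ ℕ.+ n) ≡ p → 0 < n₀ →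
    B (p ∸ n₀) n (fromℤ (ℤ.- r)) ≡ (- 1ℚ) ^ᶻ (+ (r %ℕ p) ℤ.- 1ℤ) * 1/! n₀ * fromℤ (+ (n₀ C (r %ℕ p))) [mod p ]
  B-zero r n₀ n 1+n₀+n≡p 0<n₀ = multiple⇒≡mod X ((- 1ℚ) ^ᶻ (+ (r %ℕ p) ℤ.- 1ℤ) * i * γ) (subst Multiple (begin
    -- Three multiples of p with integral coefficients: the reduction to D, the value of D, and
    -- reflection. The coefficient -(s i w) turns F - s n₀! f into f w - s i, which says that
    -- n!/(p-1)! is congruent to (-1)^n₀/n₀!.
    X - f * (D * w) + f * w * (D - - (s * (γ * σ))) + (- (s * (γ * σ))) * ((- (s * i * w)) * (F - s * (fac n₀ * f)))
      ≡⟨ solve 9 (λ X f D w s c i F n₀! →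
           X :- f :* (D :* w) :+ f :* w :* (D :- (:- (s :* c)))
             :+ (:- (s :* c)) :* ((:- (s :* i :* w)) :* (F :- s :* (n₀! :* f)))
           := X :+ f :* w :* s :* c :- s :* c :* (s :* s :* (i :* n₀!)) :* (f :* w)
             :+ s :* s :* c :* i :* (w :* F))
           refl X f D w s (γ * σ) i F (fac n₀) ⟩
    X + f * w * s * (γ * σ) - s * (γ * σ) * (s * s * (i * fac n₀)) * (f * w) + s * s * (γ * σ) * i * (w * F)
      ≡⟨ cong₂ (λ x y → X + f * w * s * (γ * σ) - s * (γ * σ) * (s * s * x) * (f * w) + s * s * (γ * σ) * i * y)
           (1/!*! n₀) (1/!*! (p ∸ 1)) ⟩
    X + f * w * s * (γ * σ) - s * (γ * σ) * (s * s * 1ℚ) * (f * w) + s * s * (γ * σ) * i * 1ℚ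
      ≡⟨ cong (λ x → X + f * w * s * (γ * σ) - s * (γ * σ) * (x * 1ℚ) * (f * w) + x * (γ * σ) * i * 1ℚ)
        (sgn*sgn n₀) ⟩
    X + f * w * s * (γ * σ) - s * (γ * σ) * (1ℚ * 1ℚ) * (f * w) + 1ℚ * (γ * σ) * i * 1ℚ
      ≡⟨ solve 7 (λ X f w s γ σ i →
           X :+ f :* w :* s :* (γ :* σ) :- s :* (γ :* σ) :* (con 1ℚ :* con 1ℚ) :* (f :* w)
             :+ con 1ℚ :* (γ :* σ) :* i :* con 1ℚ
           := X :- (:- σ) :* i :* γ)
           refl X f w s γ σ i ⟩
    X - (- σ) * i * γ
      ≡⟨ cong (λ x → X - x * i * γ) ([-1]^ᶻ[n-1] (r %ℕ p)) ⟨
    X - (- 1ℚ) ^ᶻ (+ (r %ℕ p) ℤ.- 1ℤ) * i * γ ∎)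
    (multiple-+ (multiple-+
      (B≈ n₀ n (ℤ.- r) (ℕ.<⇒≤ n₀<p) 1+n<p (trans (ℕ.+-comm n n₀) (cong ℕ.pred 1+n₀+n≡p)))
      (multiple-*ˡ (integral-* (integral-fac n) int-w) (Δ-powers-p-1 r n₀ 0<n₀ n₀<p)))
      (multiple-*ˡ (integral-neg (integral-* (integral-sgn n₀)
        (integral-* (integral-fromℤ (+ (n₀ C (r %ℕ p)))) (integral-sgn (r %ℕ p)))))
        (multiple-*ˡ (integral-neg (integral-* (integral-* (integral-sgn n₀) (integral-1/! n₀ n₀<p)) int-w))
          (factorial-reflection n₀ n 1+n₀+n≡p)))))
    where
    X = B (p ∸ n₀) n (fromℤ (ℤ.- r))
    f = fac n
    D = Δ n₀ (powers (ℤ.- r) (p ∸ 1))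
    w = 1/! (p ∸ 1)
    s = sgn n₀
    σ = sgn (r %ℕ p)
    γ = fromℤ (+ (n₀ C (r %ℕ p)))
    i = 1/! n₀
    F = fac (p ∸ 1)
    n₀<p : n₀ < p
    n₀<p = ℕ.≤-trans (s≤s (ℕ.m≤m+n n₀ n)) (ℕ.≤-reflexive 1+n₀+n≡p)
    1+n<p : suc n < p
    1+n<p = ℕ.≤-trans (s≤s (ℕ.+-monoˡ-≤ n 0<n₀)) (ℕ.≤-reflexive 1+n₀+n≡p)
    int-w : Integral w
    int-w = integral-1/! (p ∸ 1) (ℕ.≤-reflexive (ℕ.suc-pred p))

  -- Here a = n₀ - n₁, b = n₁ - 1 and n = p - 1 - a, given by equations to keep truncated
  -- subtraction out. The p from `Δ-powers-p+` joins 1/(p+b)! in `factorial-quotient`, and the signs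
  -- (-1)^a and (-1)^n₀ combine to (-1)^n₁.
  B-suc : ∀ r a b n n₀ → suc (a ℕ.+ n) ≡ p → 0 < a → b < p → a ℕ.+ suc b ≡ n₀ → n₀ ≤ p →
    B (p ∸ n₀) n (fromℤ (ℤ.- r))
      ≡ ((-1ℤ ^ suc b) / (a ! ℕ.* b !)) {{a !* b !≢0}}
        * ∑[ k ≤ n₀ ] (fromℤ (+ (n₀ C toℕ k) ℤ.* -1ℤ ^ toℕ k ℤ.* (+ toℕ k ℤ.- r) ^ suc b) * q p (+ toℕ k ℤ.- r))
      [mod p ]
  B-suc r a b n n₀ 1+a+n≡p 0<a b<p a+1+b≡n₀ n₀≤p = multiple⇒≡mod X
    (((-1ℤ ^ suc b) / (a ! ℕ.* b !)) {{a !* b !≢0}} * T) (subst Multiple (begin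
    X - fac n * (Δ n₀ (powers (ℤ.- r) (p ℕ.+ b)) * v) + (fac n * (v * π) - sgn a * i) * (sgn n₀ * T)
      ≡⟨ cong (λ D → X - fac n * (D * v) + (fac n * (v * π) - sgn a * i) * (sgn n₀ * T))
        (Δ-powers-p+ r n₀ b 1+b<n₀) ⟩
    X - fac n * (sgn n₀ * π * T * v) + (fac n * (v * π) - sgn a * i) * (sgn n₀ * T)
      ≡⟨ solve 8 (λ X f s p T v t i → X :- f :* (s :* p :* T :* v) :+ (f :* (v :* p) :- t :* i) :* (s :* T)
             := X :- t :* s :* i :* T)
           refl X (fac n) (sgn n₀) π T v (sgn a) i ⟩
    X - sgn a * sgn n₀ * i * T
      ≡⟨ cong (λ x → X - x * i * T) sgn-a*sgn-n₀ ⟩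
    X - sgn (suc b) * i * T
      ≡⟨ cong (λ x → X - x * T) (/≡*1/ (-1ℤ ^ suc b) (a ! ℕ.* b !) {{a !* b !≢0}}) ⟨
    X - ((-1ℤ ^ suc b) / (a ! ℕ.* b !)) {{a !* b !≢0}} * T ∎)
    (multiple-+ (B≈ n₀ n (ℤ.- r) n₀≤p 1+n<p n+n₀≡p+b)
      (multiple-*ʳ (factorial-quotient a b n 1+a+n≡p b<p)
        (integral-* (integral-sgn n₀) (integral-∑-*q (λ k → + (n₀ C k) ℤ.* -1ℤ ^ k) r n₀ b)))))
    where
    X = B (p ∸ n₀) n (fromℤ (ℤ.- r))
    v = 1/! (p ℕ.+ b)
    π = fromℤ (+ p)
    i = (1ℤ / (a ! ℕ.* b !)) {{a !* b !≢0}}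
    T = ∑[ k ≤ n₀ ] (fromℤ (+ (n₀ C toℕ k) ℤ.* -1ℤ ^ toℕ k ℤ.* (+ toℕ k ℤ.- r) ^ suc b) * q p (+ toℕ k ℤ.- r))
    1+b<n₀ : suc b < n₀
    1+b<n₀ = ℕ.≤-trans (ℕ.+-monoˡ-≤ (suc b) 0<a) (ℕ.≤-reflexive a+1+b≡n₀)
    1+n<p : suc n < p
    1+n<p = ℕ.≤-trans (s≤s (ℕ.+-monoˡ-≤ n 0<a)) (ℕ.≤-reflexive 1+a+n≡p)
    n+n₀≡p+b : n ℕ.+ n₀ ≡ p ℕ.+ b
    n+n₀≡p+b = begin
      n ℕ.+ n₀               ≡⟨ cong (n ℕ.+_) a+1+b≡n₀ ⟨
      n ℕ.+ (a ℕ.+ suc b)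
        ≡⟨ ℕS.solve 3 (λ n a b → n ℕS.:+ (a ℕS.:+ (ℕS.con 1 ℕS.:+ b)) ℕS.:= ℕS.con 1 ℕS.:+ (a ℕS.:+ n) ℕS.:+ b)
             refl n a b ⟩
      suc (a ℕ.+ n) ℕ.+ b    ≡⟨ cong (ℕ._+ b) 1+a+n≡p ⟩
      p ℕ.+ b                ∎
    sgn-a*sgn-n₀ : sgn a * sgn n₀ ≡ sgn (suc b)
    sgn-a*sgn-n₀ = begin
      sgn a * sgn n₀                    ≡⟨ cong (λ m → sgn a * sgn m) a+1+b≡n₀ ⟨
      sgn a * sgn (a ℕ.+ suc b)         ≡⟨ cong (sgn a *_) (sgn-+ a (suc b)) ⟩
      sgn a * (sgn a * sgn (suc b))     ≡⟨ *-assoc (sgn a) (sgn a) (sgn (suc b)) ⟨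
      sgn a * sgn a * sgn (suc b)       ≡⟨ cong (_* sgn (suc b)) (sgn*sgn a) ⟩
      1ℚ * sgn (suc b)                  ≡⟨ *-identityˡ (sgn (suc b)) ⟩
      sgn (suc b)                       ∎

corollary1p2 : (p : ℕ) .{{_ : ℕ.NonZero p}} → Prime p →
    (r : ℤ) (n₀ n₁ : ℕ) → n₀ ≤ p ∸ 1 → n₁ ≤ p ∸ 2 →
    ((n₀≤n₁ : n₀ ≤ n₁) →
    B (p ∸ n₀) (n₁ ∸ n₀) (fromℤ (ℤ.- r))
    ≡ (1ℤ / (n₁ P n₀)) {{nPk≢0 n₀≤n₁}}
    * ∑[ k ≤ n₀ ] fromℤ (+ (n₀ C toℕ k) ℤ.* -1ℤ ^ (n₀ ∸ toℕ k) ℤ.* (+ toℕ k ℤ.- r) ^ n₁)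
    [mod p ])
    × (n₀ > n₁ → n₁ ≡ 0 →
    B (p ∸ n₀) (p ∸ n₀ ℕ.+ n₁ ∸ 1) (fromℤ (ℤ.- r))
    ≡ (- 1ℚ) ^ᶻ (+ (r %ℕ p) ℤ.- 1ℤ) * (1ℤ / (n₀ !)) {{n₀ !≢0}} * fromℤ (+ (n₀ C (r %ℕ p)))
    [mod p ])
    × (n₀ > n₁ → n₁ > 0 →
    B (p ∸ n₀) (p ∸ n₀ ℕ.+ n₁ ∸ 1) (fromℤ (ℤ.- r))
    ≡ ((-1ℤ ^ n₁) / ((n₀ ∸ n₁) ! ℕ.* (n₁ ∸ 1) !)) {{(n₀ ∸ n₁) !* (n₁ ∸ 1) !≢0}}
    * ∑[ k ≤ n₀ ] (fromℤ (+ (n₀ C toℕ k) ℤ.* -1ℤ ^ toℕ k ℤ.* (+ toℕ k ℤ.- r) ^ n₁) * q p (+ toℕ k ℤ.- r))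
    [mod p ])
corollary1p2 p p-prime r n₀ n₁ n₀≤p-1 n₁≤p-2 =
  (λ n₀≤n₁ → B-≤ r n₀ n₁ 1+n₁<p n₀≤n₁) ,
  (λ where n₁<n₀ refl → B-zero r n₀ (p ∸ n₀ ℕ.+ 0 ∸ 1) (index-sum (ℕ.<⇒≤ n₁<n₀)) n₁<n₀) ,
  positive n₁
  where
  open Localisation p-prime
  n₀<p : n₀ < p
  n₀<p = ℕ.≤-trans (s≤s n₀≤p-1) (ℕ.≤-reflexive (ℕ.suc-pred p))
  1+n₁<p : suc n₁ < p
  1+n₁<p = ℕ.≤-trans (s≤s (s≤s n₁≤p-2)) (ℕ.≤-reflexive (ℕ.m+[n∸m]≡n 1<p))
  -- Identifies the index p - n₀ + n - 1 as p - 1 - (n₀ - n). The truncated `∸ 1` is a true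
  -- subtraction because n₀ < p.
  index-sum : ∀ {n} → n ≤ n₀ → suc (n₀ ∸ n ℕ.+ (p ∸ n₀ ℕ.+ n ∸ 1)) ≡ p
  index-sum {n} n≤n₀ = begin
    suc (n₀ ∸ n ℕ.+ (p ∸ n₀ ℕ.+ n ∸ 1))   ≡⟨ ℕ.+-suc (n₀ ∸ n) (p ∸ n₀ ℕ.+ n ∸ 1) ⟨
    n₀ ∸ n ℕ.+ suc (p ∸ n₀ ℕ.+ n ∸ 1)     ≡⟨ cong (n₀ ∸ n ℕ.+_) (ℕ.suc-pred (p ∸ n₀ ℕ.+ n)) ⟩
    n₀ ∸ n ℕ.+ (p ∸ n₀ ℕ.+ n)
      ≡⟨ ℕS.solve 3 (λ x y z → x ℕS.:+ (y ℕS.:+ z) ℕS.:= x ℕS.:+ z ℕS.:+ y) refl (n₀ ∸ n) (p ∸ n₀) n ⟩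
    n₀ ∸ n ℕ.+ n ℕ.+ (p ∸ n₀)             ≡⟨ cong (ℕ._+ (p ∸ n₀)) (ℕ.m∸n+n≡m n≤n₀) ⟩
    n₀ ℕ.+ (p ∸ n₀)                       ≡⟨ ℕ.m+[n∸m]≡n (ℕ.<⇒≤ n₀<p) ⟩
    p                                     ∎
    where
    instance
      _ = ℕ.>-nonZero (ℕ.≤-trans (ℕ.m<n⇒0<n∸m n₀<p) (ℕ.m≤m+n (p ∸ n₀) n))
  positive : ∀ n₁ → n₀ > n₁ → n₁ > 0 →
    B (p ∸ n₀) (p ∸ n₀ ℕ.+ n₁ ∸ 1) (fromℤ (ℤ.- r))
      ≡ ((-1ℤ ^ n₁) / ((n₀ ∸ n₁) ! ℕ.* (n₁ ∸ 1) !)) {{(n₀ ∸ n₁) !* (n₁ ∸ 1) !≢0}}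
        * ∑[ k ≤ n₀ ] (fromℤ (+ (n₀ C toℕ k) ℤ.* -1ℤ ^ toℕ k ℤ.* (+ toℕ k ℤ.- r) ^ n₁) * q p (+ toℕ k ℤ.- r))
      [mod p ]
  positive (suc b) 1+b<n₀ _ = B-suc r (n₀ ∸ suc b) b (p ∸ n₀ ℕ.+ suc b ∸ 1) n₀
    (index-sum (ℕ.<⇒≤ 1+b<n₀)) (ℕ.m<n⇒0<n∸m 1+b<n₀) (ℕ.<-trans (ℕ.n<1+n b) (ℕ.<-trans 1+b<n₀ n₀<p))
      (ℕ.m∸n+n≡m (ℕ.<⇒≤ 1+b<n₀)) (ℕ.<⇒≤ n₀<p)
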